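{- For the $m\times m$ matrix multiplication tensor $\mathcal M_m$ one has $\underline R(\mathcal M_m)\ge\frac32m^2-\frac12$ if $m$ is odd, and $\underline R(\mathcal M_m)\ge\frac32m^2-2$ if $m$ is even.
   Context: $\mathcal M_m=\sum_{i,j,l=1}^m|ij\rangle\otimes|jl\rangle\otimes|li\rangle\in\bigotimes^3\mathbb C^{m\times m}$, where $|ij\rangle$ denotes the standard basis of $\mathbb C^{m\times m}$. The border rank $\underline R(w)$ of a tensor $w$ is the least $r$ such that $w$ is a limit of tensors each expressible as a sum of at most $r$ tensors of the form $u\otimes v\otimes x$. -}

module Defs where

open import Algebra.Bundles.Raw using (RawMonoid)
import Algebra.Definitions.RawMonoid as RawMonoidSum
open import Data.Bool using (if_then_else_)
open import Data.Fin using (Fin)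
import Data.Fin.Properties as Fin
open import Data.Integer using (+_)
open import Data.Nat as ℕ using (ℕ)
open import Data.Nat.Induction using (<-rec)
import Data.Nat.Properties as ℕ
open import Data.Product using (∃; ∃-syntax; _×_; _,_)
open import Data.Product.Properties using (≡-dec)
open import Data.Rational as ℚ using (ℚ; 0ℚ; 1ℚ; ½; ∣_∣)
import Data.Rational.Properties as ℚ
open import Data.Rational.Solver using (module +-*-Solver)
open import Level using (0ℓ)
open import Relation.Binary.PropositionalEquality using (_≡_; refl; sym; trans; cong; subst)
open import Relation.Nullary using (¬_; does)

IsCauchy : (ℕ → ℚ) → Set
IsCauchy x = ∀ ε → 0ℚ ℚ.< ε →
  ∃[ N ] (∀ k n → N ℕ.≤ k → N ℕ.≤ n → ∣ x k ℚ.- x n ∣ ℚ.< ε)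

private
  neg-sub : ∀ a b → ℚ.- (a ℚ.- b) ≡ (ℚ.- a) ℚ.- (ℚ.- b)
  neg-sub = solve 2 (λ a b → :- (a :- b) := (:- a) :- (:- b)) refl
    where open +-*-Solver

  add-sub : ∀ a b c d → (a ℚ.+ b) ℚ.- (c ℚ.+ d) ≡ (a ℚ.- c) ℚ.+ (b ℚ.- d)
  add-sub = solve 4 (λ a b c d → (a :+ b) :- (c :+ d) := (a :- c) :+ (b :- d)) refl
    where open +-*-Solver

  mul-sub : ∀ a b c d → a ℚ.* b ℚ.- c ℚ.* d ≡ a ℚ.* (b ℚ.- d) ℚ.+ d ℚ.* (a ℚ.- c)
  mul-sub = solve 4 (λ a b c d → a :* b :- c :* d := a :* (b :- d) :+ d :* (a :- c)) refl
    where open +-*-Solver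

  sub-add : ∀ a b → a ≡ (a ℚ.- b) ℚ.+ b
  sub-add = solve 2 (λ a b → a := (a :- b) :+ b) refl
    where open +-*-Solver

  half-pos : ∀ {ε} → 0ℚ ℚ.< ε → 0ℚ ℚ.< ½ ℚ.* ε
  half-pos {ε} 0<ε = subst (ℚ._< ½ ℚ.* ε) (ℚ.*-zeroʳ ½) (ℚ.*-monoʳ-<-pos ½ 0<ε)

  half+half : ∀ ε → ½ ℚ.* ε ℚ.+ ½ ℚ.* ε ≡ ε
  half+half ε = trans (sym (ℚ.*-distribʳ-+ ε ½ ½)) (ℚ.*-identityˡ ε)

  const-cauchy : ∀ q → IsCauchy (λ _ → q)
  const-cauchy q ε 0<ε = 0 , λ _ _ _ _ →
    subst (ℚ._< ε) (sym (cong ∣_∣ (ℚ.+-inverseʳ q))) 0<ε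

  neg-cauchy : ∀ x → IsCauchy x → IsCauchy (λ n → ℚ.- x n)
  neg-cauchy x cx ε 0<ε with cx ε 0<ε
  ... | N , p = N , λ k n N≤k N≤n →
    subst (ℚ._< ε)
      (trans (sym (ℚ.∣-p∣≡∣p∣ (x k ℚ.- x n)))
             (cong ∣_∣ (neg-sub (x k) (x n))))
      (p k n N≤k N≤n)

  add-cauchy : ∀ x y → IsCauchy x → IsCauchy y → IsCauchy (λ n → x n ℚ.+ y n)
  add-cauchy x y cx cy ε 0<ε with cx _ (half-pos 0<ε) | cy _ (half-pos 0<ε)
  ... | M , p | N , q = M ℕ.⊔ N , λ k n hk hn → let open ℚ.≤-Reasoning in begin-strict
      ∣ (x k ℚ.+ y k) ℚ.- (x n ℚ.+ y n) ∣
        ≡⟨ cong ∣_∣ (add-sub (x k) (y k) (x n) (y n)) ⟩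
      ∣ (x k ℚ.- x n) ℚ.+ (y k ℚ.- y n) ∣
        ≤⟨ ℚ.∣p+q∣≤∣p∣+∣q∣ (x k ℚ.- x n) (y k ℚ.- y n) ⟩
      ∣ x k ℚ.- x n ∣ ℚ.+ ∣ y k ℚ.- y n ∣
        <⟨ ℚ.+-mono-< (p k n (ℕ.m⊔n≤o⇒m≤o M N hk) (ℕ.m⊔n≤o⇒m≤o M N hn))
                      (q k n (ℕ.m⊔n≤o⇒n≤o M N hk) (ℕ.m⊔n≤o⇒n≤o M N hn)) ⟩
      ½ ℚ.* ε ℚ.+ ½ ℚ.* ε
        ≡⟨ half+half ε ⟩
      ε ∎

  bounded : ∀ x → IsCauchy x →
            ∃[ B ] (0ℚ ℚ.< B × ∃[ N ] (∀ n → N ℕ.≤ n → ∣ x n ∣ ℚ.≤ B))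
  bounded x cx with cx 1ℚ (ℚ.positive⁻¹ 1ℚ)
  ... | N , p = 1ℚ ℚ.+ ∣ x N ∣
              , ℚ.+-mono-<-≤ (ℚ.positive⁻¹ 1ℚ) (ℚ.0≤∣p∣ (x N))
              , N , λ n N≤n → let open ℚ.≤-Reasoning in begin
      ∣ x n ∣
        ≡⟨ cong ∣_∣ (sub-add (x n) (x N)) ⟩
      ∣ (x n ℚ.- x N) ℚ.+ x N ∣
        ≤⟨ ℚ.∣p+q∣≤∣p∣+∣q∣ (x n ℚ.- x N) (x N) ⟩
      ∣ x n ℚ.- x N ∣ ℚ.+ ∣ x N ∣
        ≤⟨ ℚ.+-monoˡ-≤ ∣ x N ∣ (ℚ.<⇒≤ (p n N N≤n ℕ.≤-refl)) ⟩
      1ℚ ℚ.+ ∣ x N ∣ ∎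

  scale : ∀ {B ε} → 0ℚ ℚ.< B → 0ℚ ℚ.< ε →
          ∃[ δ ] (0ℚ ℚ.< δ × (∀ {a d} → a ℚ.≤ B → 0ℚ ℚ.≤ d → d ℚ.< δ → a ℚ.* d ℚ.< ½ ℚ.* ε))
  scale {B} {ε} 0<B 0<ε = δ , 0<δ , bound
    where
    instance
      posB : ℚ.Positive B
      posB = ℚ.positive 0<B
      nzB : ℚ.NonZero B
      nzB = ℚ.pos⇒nonZero B
      posB⁻¹ : ℚ.Positive (ℚ.1/ B)
      posB⁻¹ = ℚ.1/pos⇒pos B
    δ : ℚ
    δ = (ℚ.1/ B) ℚ.* (½ ℚ.* ε)
    0<δ : 0ℚ ℚ.< δ
    0<δ = subst (ℚ._< δ) (ℚ.*-zeroʳ (ℚ.1/ B)) (ℚ.*-monoʳ-<-pos (ℚ.1/ B) (half-pos 0<ε))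
    bound : ∀ {a d} → a ℚ.≤ B → 0ℚ ℚ.≤ d → d ℚ.< δ → a ℚ.* d ℚ.< ½ ℚ.* ε
    bound {a} {d} a≤B 0≤d d<δ = let open ℚ.≤-Reasoning in begin-strict
      a ℚ.* d                         ≤⟨ ℚ.*-monoʳ-≤-nonNeg d {{ℚ.nonNegative 0≤d}} a≤B ⟩
      B ℚ.* d                         <⟨ ℚ.*-monoʳ-<-pos B d<δ ⟩
      B ℚ.* ((ℚ.1/ B) ℚ.* (½ ℚ.* ε))  ≡⟨ sym (ℚ.*-assoc B (ℚ.1/ B) (½ ℚ.* ε)) ⟩
      (B ℚ.* (ℚ.1/ B)) ℚ.* (½ ℚ.* ε)  ≡⟨ cong (ℚ._* (½ ℚ.* ε)) (ℚ.*-inverseʳ B) ⟩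
      1ℚ ℚ.* (½ ℚ.* ε)                ≡⟨ ℚ.*-identityˡ (½ ℚ.* ε) ⟩
      ½ ℚ.* ε                         ∎

  mul-diff : ∀ a b c d {s t} → ∣ a ∣ ℚ.* ∣ b ℚ.- d ∣ ℚ.< s → ∣ d ∣ ℚ.* ∣ a ℚ.- c ∣ ℚ.< t →
             ∣ a ℚ.* b ℚ.- c ℚ.* d ∣ ℚ.< s ℚ.+ t
  mul-diff a b c d {s} {t} h₁ h₂ = let open ℚ.≤-Reasoning in begin-strict
    ∣ a ℚ.* b ℚ.- c ℚ.* d ∣
      ≡⟨ cong ∣_∣ (mul-sub a b c d) ⟩
    ∣ a ℚ.* (b ℚ.- d) ℚ.+ d ℚ.* (a ℚ.- c) ∣
      ≤⟨ ℚ.∣p+q∣≤∣p∣+∣q∣ (a ℚ.* (b ℚ.- d)) (d ℚ.* (a ℚ.- c)) ⟩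
    ∣ a ℚ.* (b ℚ.- d) ∣ ℚ.+ ∣ d ℚ.* (a ℚ.- c) ∣
      <⟨ ℚ.+-mono-< (subst (ℚ._< s) (sym (ℚ.∣p*q∣≡∣p∣*∣q∣ a (b ℚ.- d))) h₁)
                    (subst (ℚ._< t) (sym (ℚ.∣p*q∣≡∣p∣*∣q∣ d (a ℚ.- c))) h₂) ⟩
    s ℚ.+ t ∎

  mul-cauchy : ∀ x y → IsCauchy x → IsCauchy y → IsCauchy (λ n → x n ℚ.* y n)
  mul-cauchy x y cx cy ε 0<ε =
    let A , 0<A , Nx , ∣x∣≤A = bounded x cx
        B , 0<B , Ny , ∣y∣≤B = bounded y cy
        δ , 0<δ , boundA     = scale {A} {ε} 0<A 0<ε
        η , 0<η , boundB     = scale {B} {ε} 0<B 0<ε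
        M , q                = cy δ 0<δ
        L , p                = cx η 0<η
    in (Nx ℕ.⊔ Ny) ℕ.⊔ (M ℕ.⊔ L) , λ k n hk hn →
      let hk₁ = ℕ.m⊔n≤o⇒m≤o (Nx ℕ.⊔ Ny) (M ℕ.⊔ L) hk
          hk₂ = ℕ.m⊔n≤o⇒n≤o (Nx ℕ.⊔ Ny) (M ℕ.⊔ L) hk
          hn₁ = ℕ.m⊔n≤o⇒m≤o (Nx ℕ.⊔ Ny) (M ℕ.⊔ L) hn
          hn₂ = ℕ.m⊔n≤o⇒n≤o (Nx ℕ.⊔ Ny) (M ℕ.⊔ L) hn
      in subst (∣ x k ℚ.* y k ℚ.- x n ℚ.* y n ∣ ℚ.<_) (half+half ε)
           (mul-diff (x k) (y k) (x n) (y n)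
             (boundA {∣ x k ∣} {∣ y k ℚ.- y n ∣}
                (∣x∣≤A k (ℕ.m⊔n≤o⇒m≤o Nx Ny hk₁)) (ℚ.0≤∣p∣ (y k ℚ.- y n))
                (q k n (ℕ.m⊔n≤o⇒m≤o M L hk₂) (ℕ.m⊔n≤o⇒m≤o M L hn₂)))
             (boundB {∣ y n ∣} {∣ x k ℚ.- x n ∣}
                (∣y∣≤B n (ℕ.m⊔n≤o⇒n≤o Nx Ny hn₁)) (ℚ.0≤∣p∣ (x k ℚ.- x n))
                (p k n (ℕ.m⊔n≤o⇒n≤o M L hk₂) (ℕ.m⊔n≤o⇒n≤o M L hn₂))))

-- Cauchy sequences are not quotiented: equality of reals is _≈ℝ_, not _≡_.
record ℝ : Set where
  constructor mkℝ
  field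
    seq    : ℕ → ℚ
    cauchy : IsCauchy seq

open ℝ public

infix  4 _≈ℝ_ _<ℝ_
infixl 6 _+ℝ_ _-ℝ_
infixl 7 _*ℝ_
infix  8 -ℝ_

_≈ℝ_ : ℝ → ℝ → Set
x ≈ℝ y = ∀ ε → 0ℚ ℚ.< ε → ∃[ N ] (∀ n → N ℕ.≤ n → ∣ seq x n ℚ.- seq y n ∣ ℚ.< ε)

-- The gap δ is what makes the order strict: x n < y n for all large n
-- would still allow x ≈ℝ y.
_<ℝ_ : ℝ → ℝ → Set
x <ℝ y = ∃[ δ ] (0ℚ ℚ.< δ × ∃[ N ] (∀ n → N ℕ.≤ n → δ ℚ.< seq y n ℚ.- seq x n))

fromℚ : ℚ → ℝ
fromℚ q = mkℝ (λ _ → q) (const-cauchy q)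

0ℝ 1ℝ : ℝ
0ℝ = fromℚ 0ℚ
1ℝ = fromℚ 1ℚ

_+ℝ_ : ℝ → ℝ → ℝ
x +ℝ y = mkℝ (λ n → seq x n ℚ.+ seq y n) (add-cauchy (seq x) (seq y) (cauchy x) (cauchy y))

-ℝ_ : ℝ → ℝ
-ℝ x = mkℝ (λ n → ℚ.- seq x n) (neg-cauchy (seq x) (cauchy x))

_-ℝ_ : ℝ → ℝ → ℝ
x -ℝ y = x +ℝ (-ℝ y)

_*ℝ_ : ℝ → ℝ → ℝ
x *ℝ y = mkℝ (λ n → seq x n ℚ.* seq y n) (mul-cauchy (seq x) (seq y) (cauchy x) (cauchy y))

record ℂ : Set where
  constructor _+i_
  field
    re im : ℝ

open ℂ public

infix  4 _≈_ _⟶_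
infixl 6 _+_ _-_
infixl 7 _*_

_≈_ : ℂ → ℂ → Set
z ≈ w = re z ≈ℝ re w × im z ≈ℝ im w

0ℂ 1ℂ : ℂ
0ℂ = 0ℝ +i 0ℝ
1ℂ = 1ℝ +i 0ℝ

_+_ _-_ _*_ : ℂ → ℂ → ℂ
z + w = (re z +ℝ re w) +i (im z +ℝ im w)
z - w = (re z -ℝ re w) +i (im z -ℝ im w)
z * w = (re z *ℝ re w -ℝ im z *ℝ im w) +i (re z *ℝ im w +ℝ im z *ℝ re w)

∣_∣² : ℂ → ℝ
∣ z ∣² = re z *ℝ re z +ℝ im z *ℝ im z

-- |z k − w| < ε is written in squared form, which avoids the square root.
_⟶_ : (ℕ → ℂ) → ℂ → Set
z ⟶ w = ∀ ε → 0ℝ <ℝ ε → ∃[ N ] (∀ k → N ℕ.≤ k → ∣ z k - w ∣² <ℝ ε *ℝ ε)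

+-rawMonoid : RawMonoid 0ℓ 0ℓ
+-rawMonoid = record { Carrier = ℂ ; _≈_ = _≈_ ; _∙_ = _+_ ; ε = 0ℂ }

open RawMonoidSum +-rawMonoid public using (sum)

-- Tensor m is ⊗³ ℂ^{m×m} in coordinates for the basis |ij⟩ ⊗ |kl⟩ ⊗ |pq⟩.
Index : ℕ → Set
Index m = Fin m × Fin m

Mat : ℕ → Set
Mat m = Index m → ℂ

Tensor : ℕ → Set
Tensor m = Index m → Index m → Index m → ℂ

infix 4 _≈ᵀ_ _⟶ᵀ_

_≈ᵀ_ : ∀ {m} → Tensor m → Tensor m → Set
t ≈ᵀ w = ∀ a b c → t a b c ≈ w a b c

-- Coordinatewise convergence, i.e. convergence in any norm on this
-- finite-dimensional space.
_⟶ᵀ_ : ∀ {m} → (ℕ → Tensor m) → Tensor m → Set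
t ⟶ᵀ w = ∀ a b c → (λ k → t k a b c) ⟶ w a b c

sumᵀ : ∀ {m n} → (Fin n → Tensor m) → Tensor m
sumᵀ t a b c = sum (λ p → t p a b c)

⟨_⊗_⊗_⟩ : ∀ {m} → Mat m → Mat m → Mat m → Tensor m
⟨ u ⊗ v ⊗ x ⟩ a b c = u a * v b * x c

∣_,_⟩ : ∀ {m} → Fin m → Fin m → Mat m
∣ i , j ⟩ a = if does (≡-dec Fin._≟_ Fin._≟_ a (i , j)) then 1ℂ else 0ℂ

𝓜 : ∀ m → Tensor m
𝓜 m = sumᵀ λ i → sumᵀ λ j → sumᵀ λ l → ⟨ ∣ i , j ⟩ ⊗ ∣ j , l ⟩ ⊗ ∣ l , i ⟩ ⟩

Rank≤ : ∀ {m} → Tensor m → ℕ → Set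
Rank≤ {m} t r = ∃[ s ] (s ℕ.≤ r ×
  ∃ λ (u : Fin s → Mat m) → ∃ λ (v : Fin s → Mat m) → ∃ λ (x : Fin s → Mat m) →
    t ≈ᵀ sumᵀ (λ p → ⟨ u p ⊗ v p ⊗ x p ⟩))

BorderRank≤ : ∀ {m} → Tensor m → ℕ → Set
BorderRank≤ {m} w r = ∃ λ (t : ℕ → Tensor m) → (∀ k → Rank≤ (t k) r) × t ⟶ᵀ w

IsBorderRank : ∀ {m} → Tensor m → ℕ → Set
IsBorderRank w r = BorderRank≤ w r × (∀ s → BorderRank≤ w s → r ℕ.≤ s)

-- The least r cannot in general be computed from an upper bound, but it
-- cannot fail to exist either. As inequalities between natural (or
-- rational) numbers are ¬¬-stable, a lower bound on every r with
-- IsBorderRank w r is therefore one on every s with BorderRank≤ w s.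
borderRank-¬¬exists : ∀ {m} (w : Tensor m) s → BorderRank≤ w s →
                      ¬ ¬ (∃[ r ] (r ℕ.≤ s × IsBorderRank w r))
borderRank-¬¬exists w = <-rec _ λ s below bs none →
  none (s , ℕ.≤-refl , bs , λ s′ bs′ → ℕ.≮⇒≥ λ s′<s →
    below s′<s bs′ λ (r , r≤s′ , br) → none (r , ℕ.≤-trans r≤s′ (ℕ.<⇒≤ s′<s) , br))

toℚ : ℕ → ℚ
toℚ n = + n ℚ./ 1

{-# OPTIONS --safe #-}
-- Strassen's commutator argument. Contract the first factor of a tensor t with three fixed matrices
-- A₀, A₁, A₂, which gives linear maps t₀, t₁, t₂, and look for x₀, x₁, x₂ with tₖ(xⱼ) = tⱼ(xₖ) for
-- all j, k. If t has rank s, this holds once the three values that the second factor of each rank one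
-- summand takes on x are proportional to the three contractions of its first factor, which is 2s linear
-- conditions on 3m² unknowns. For 𝓜 the equations read Aₖ xⱼ = Aⱼ xₖ; with A₀ = 1 they imply
-- [A₁ , A₂] x₀ = 0, so x = 0 if the commutator is invertible; by continuity x = 0 also for every t
-- near 𝓜, hence 2s ≥ 3m². A suitable choice for m ≥ 2 is A₁ = diag(0, …, m−1), A₂ a cyclic permutation.
-- As the operations on Cauchy reals act termwise, late terms of the sequences turn a complex
-- approximation of 𝓜 into one over ℚ[i], where equality is decidable.
module Submission where

open import Defs using (𝓜; IsBorderRank; toℚ)
open import Data.Integer using (+_)
open import Data.Nat using (ℕ; _^_)
open import Data.Nat.Divisibility using (_∣_)
open import Data.Product using (_×_)
open import Data.Rational using (_/_; _*_; _-_; _≤_; ½)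
open import Relation.Nullary using (¬_)

open import Algebra.Bundles using (CommutativeRing)
import Algebra.Properties.Semiring.Sum as SemiringSum
import Algebra.Solver.Ring.AlmostCommutativeRing as ACR
import Algebra.Solver.Ring.Simple as RingSolver
open import Data.Bool using (true; false; if_then_else_)
open import Data.Fin as Fin using (Fin; zero; suc; punchIn; combine; remQuot; fromℕ; inject₁)
open import Data.Fin.Patterns using (0F; 1F; 2F)
import Data.Fin.Properties as Fin
open import Data.Fin.Relation.Unary.Top using (view; ‵fromℕ; ‵inject₁)
import Data.Integer as ℤ
import Data.Integer.Properties as ℤ
open import Data.Nat as ℕ using (zero; suc; z≤n; s≤s)
import Data.Nat.Properties as ℕ
open import Data.Product using (∃; ∃-syntax; ∃₂; _,_; proj₁; proj₂)
open import Data.Product.Properties using (≡-dec)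
open import Data.Rational using (ℚ; 0ℚ; 1ℚ; _+_; -_; _<_; ∣_∣; 1/_; toℚᵘ)
open import Data.Rational using (NonZero; Positive; ≢-nonZero; positive; nonNegative; nonPositive)
import Data.Rational.Properties as ℚ
open import Data.Rational.Solver using (module +-*-Solver)
import Data.Rational.Unnormalised as ℚᵘ
import Data.Rational.Unnormalised.Properties as ℚᵘ
open import Data.Sum using (inj₁; inj₂)
open import Data.Vec.Functional using (_∷_)
import Defs
open import Defs using (Index; BorderRank≤; ℂ; seq; re; im; fromℚ)
open import Function using (_∘_)
open import Level using (0ℓ)
open import Relation.Binary.Definitions using (DecidableEquality)
open import Relation.Binary.PropositionalEquality using (_≡_; _≢_; refl; sym; trans; cong; cong₂; subst; subst₂)
open import Relation.Binary.PropositionalEquality using (isEquivalence; module ≡-Reasoning)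
open import Relation.Nullary using (yes; no; does; contradiction)
open import Relation.Nullary.Decidable using (map′; _×-dec_; ¬?; decidable-stable; toWitness; toWitnessFalse)

-- Gaussian rationals

infix  8 -ᶜ_
infixl 7 _*ᶜ_
infixl 6 _+ᶜ_ _-ᶜ_

record ℚ[i] : Set where
  constructor _+𝕚_
  field
    Re Im : ℚ

open ℚ[i]

0ᶜ 1ᶜ : ℚ[i]
0ᶜ = 0ℚ +𝕚 0ℚ
1ᶜ = 1ℚ +𝕚 0ℚ

_+ᶜ_ _*ᶜ_ : ℚ[i] → ℚ[i] → ℚ[i]
(a +𝕚 b) +ᶜ (c +𝕚 d) = (a + c) +𝕚 (b + d)
(a +𝕚 b) *ᶜ (c +𝕚 d) = (a * c - b * d) +𝕚 (a * d + b * c)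

-ᶜ_ : ℚ[i] → ℚ[i]
-ᶜ (a +𝕚 b) = (- a) +𝕚 (- b)

_-ᶜ_ : ℚ[i] → ℚ[i] → ℚ[i]
z -ᶜ w = z +ᶜ (-ᶜ w)

_≟ᶜ_ : DecidableEquality ℚ[i]
(a +𝕚 b) ≟ᶜ (c +𝕚 d) =
  map′ (λ (p , q) → cong₂ _+𝕚_ p q) (λ p → cong Re p , cong Im p) (a ℚ.≟ c ×-dec b ℚ.≟ d)

ℚ[i]-commutativeRing : CommutativeRing 0ℓ 0ℓ
ℚ[i]-commutativeRing = record
  { _≈_ = _≡_
  ; _+_ = _+ᶜ_
  ; _*_ = _*ᶜ_
  ; -_  = λ z → -ᶜ z
  ; 0#  = 0ᶜ
  ; 1#  = 1ᶜ
  ; isCommutativeRing = record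
    { isRing = record
      { +-isAbelianGroup = record
        { isGroup = record
          { isMonoid = record
            { isSemigroup = record
              { isMagma = record { isEquivalence = isEquivalence ; ∙-cong = cong₂ _+ᶜ_ }
              ; assoc = λ x y z → cong₂ _+𝕚_ (ℚ.+-assoc (Re x) (Re y) (Re z)) (ℚ.+-assoc (Im x) (Im y) (Im z))
              }
            ; identity = (λ x → cong₂ _+𝕚_ (ℚ.+-identityˡ (Re x)) (ℚ.+-identityˡ (Im x)))
                       , (λ x → cong₂ _+𝕚_ (ℚ.+-identityʳ (Re x)) (ℚ.+-identityʳ (Im x)))
            }
          ; inverse = (λ x → cong₂ _+𝕚_ (ℚ.+-inverseˡ (Re x)) (ℚ.+-inverseˡ (Im x)))
                    , (λ x → cong₂ _+𝕚_ (ℚ.+-inverseʳ (Re x)) (ℚ.+-inverseʳ (Im x)))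
          ; ⁻¹-cong = cong (λ z → -ᶜ z)
          }
        ; comm = λ x y → cong₂ _+𝕚_ (ℚ.+-comm (Re x) (Re y)) (ℚ.+-comm (Im x) (Im y))
        }
      ; *-cong = cong₂ _*ᶜ_
      ; *-assoc = λ (a +𝕚 b) (c +𝕚 d) (e +𝕚 f) → cong₂ _+𝕚_
          (solve 6 (λ a b c d e f → (a :* c :- b :* d) :* e :- (a :* d :+ b :* c) :* f
                                  := a :* (c :* e :- d :* f) :- b :* (c :* f :+ d :* e)) refl a b c d e f)
          (solve 6 (λ a b c d e f → (a :* c :- b :* d) :* f :+ (a :* d :+ b :* c) :* e
                                  := a :* (c :* f :+ d :* e) :+ b :* (c :* e :- d :* f)) refl a b c d e f)
      ; *-identity = (λ (a +𝕚 b) → cong₂ _+𝕚_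
                       (solve 2 (λ a b → con 1ℚ :* a :- con 0ℚ :* b := a) refl a b)
                       (solve 2 (λ a b → con 1ℚ :* b :+ con 0ℚ :* a := b) refl a b))
                   , (λ (a +𝕚 b) → cong₂ _+𝕚_
                       (solve 2 (λ a b → a :* con 1ℚ :- b :* con 0ℚ := a) refl a b)
                       (solve 2 (λ a b → a :* con 0ℚ :+ b :* con 1ℚ := b) refl a b))
      ; distrib = (λ (a +𝕚 b) (c +𝕚 d) (e +𝕚 f) → cong₂ _+𝕚_
                    (solve 6 (λ a b c d e f → a :* (c :+ e) :- b :* (d :+ f)
                                            := (a :* c :- b :* d) :+ (a :* e :- b :* f)) refl a b c d e f)
                    (solve 6 (λ a b c d e f → a :* (d :+ f) :+ b :* (c :+ e)
                                            := (a :* d :+ b :* c) :+ (a :* f :+ b :* e)) refl a b c d e f))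
                , (λ (a +𝕚 b) (c +𝕚 d) (e +𝕚 f) → cong₂ _+𝕚_
                    (solve 6 (λ a b c d e f → (c :+ e) :* a :- (d :+ f) :* b
                                            := (c :* a :- d :* b) :+ (e :* a :- f :* b)) refl a b c d e f)
                    (solve 6 (λ a b c d e f → (c :+ e) :* b :+ (d :+ f) :* a
                                            := (c :* b :+ d :* a) :+ (e :* b :+ f :* a)) refl a b c d e f))
      }
    ; *-comm = λ (a +𝕚 b) (c +𝕚 d) → cong₂ _+𝕚_
        (solve 4 (λ a b c d → a :* c :- b :* d := c :* a :- d :* b) refl a b c d)
        (solve 4 (λ a b c d → a :* d :+ b :* c := c :* b :+ d :* a) refl a b c d)
    }
  }
  where open +-*-Solver

module ℂᵣ = CommutativeRing ℚ[i]-commutativeRing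
module ℂ-Solver = RingSolver (ACR.fromCommutativeRing ℚ[i]-commutativeRing) _≟ᶜ_

open SemiringSum ℂᵣ.semiring
  using (sum; sum-cong-≗; sum-replicate-zero; ∑-distrib-+; *-distribˡ-sum; *-distribʳ-sum)

infixr 5 ∑-syntax

∑-syntax : ∀ n → (Fin n → ℚ[i]) → ℚ[i]
∑-syntax _ = sum

syntax ∑-syntax n (λ i → z) = ∑[ i < n ] z

*-zero-divisor : ∀ {p q} → p ≢ 0ℚ → p * q ≡ 0ℚ → q ≡ 0ℚ
*-zero-divisor {p} {q} p≢0 pq≡0 = begin
  q                 ≡⟨ ℚ.*-identityˡ q ⟨
  1ℚ * q            ≡⟨ cong (_* q) (ℚ.*-inverseˡ p) ⟨
  1/ p * p * q      ≡⟨ ℚ.*-assoc (1/ p) p q ⟩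
  1/ p * (p * q)    ≡⟨ cong (1/ p *_) pq≡0 ⟩
  1/ p * 0ℚ         ≡⟨ ℚ.*-zeroʳ (1/ p) ⟩
  0ℚ                ∎
  where
  open ≡-Reasoning
  instance
    p-nonZero : NonZero p
    p-nonZero = ≢-nonZero p≢0

0≤p² : ∀ p → 0ℚ ≤ p * p
0≤p² p with ℚ.≤-total 0ℚ p
... | inj₁ 0≤p = subst (_≤ p * p) (ℚ.*-zeroʳ p) (ℚ.*-monoˡ-≤-nonNeg p {{nonNegative 0≤p}} 0≤p)
... | inj₂ p≤0 = subst (_≤ p * p) (ℚ.*-zeroʳ p) (ℚ.*-monoˡ-≤-nonPos p {{nonPositive p≤0}} p≤0)

p²≤p²+q² : ∀ p q → p * p ≤ p * p + q * q
p²≤p²+q² p q = subst (_≤ p * p + q * q) (ℚ.+-identityʳ (p * p)) (ℚ.+-monoʳ-≤ (p * p) (0≤p² q))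

q²≤p²+q² : ∀ p q → q * q ≤ p * p + q * q
q²≤p²+q² p q = subst (q * q ≤_) (ℚ.+-comm (q * q) (p * p)) (p²≤p²+q² q p)

p²≤0⇒p≡0 : ∀ p → p * p ≤ 0ℚ → p ≡ 0ℚ
p²≤0⇒p≡0 p p²≤0 with p ℚ.≟ 0ℚ
... | yes p≡0 = p≡0
... | no  p≢0 = *-zero-divisor p≢0 (ℚ.≤-antisym p²≤0 (0≤p² p))

-- Multiplying z w by the conjugate of z shows that |z|² annihilates both parts of w, and |z|² is
-- nonzero as a sum of two squares that do not both vanish.
*ᶜ-zero-divisor : ∀ {z w} → z ≢ 0ᶜ → z *ᶜ w ≡ 0ᶜ → w ≡ 0ᶜ
*ᶜ-zero-divisor {a +𝕚 b} {c +𝕚 d} z≢0 zw≡0 = cong₂ _+𝕚_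
  (*-zero-divisor N≢0 (trans
    (solve 4 (λ a b c d → (a :* a :+ b :* b) :* c := a :* (a :* c :- b :* d) :+ b :* (a :* d :+ b :* c)) refl a b c d)
    (trans (cong₂ (λ p q → a * p + b * q) (cong Re zw≡0) (cong Im zw≡0))
      (solve 2 (λ a b → a :* con 0ℚ :+ b :* con 0ℚ := con 0ℚ) refl a b))))
  (*-zero-divisor N≢0 (trans
    (solve 4 (λ a b c d → (a :* a :+ b :* b) :* d := a :* (a :* d :+ b :* c) :- b :* (a :* c :- b :* d)) refl a b c d)
    (trans (cong₂ (λ p q → a * q - b * p) (cong Re zw≡0) (cong Im zw≡0))
      (solve 2 (λ a b → a :* con 0ℚ :- b :* con 0ℚ := con 0ℚ) refl a b))))
  where
  open +-*-Solver
  N≢0 : a * a + b * b ≢ 0ℚ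
  N≢0 N≡0 = z≢0 (cong₂ _+𝕚_
    (p²≤0⇒p≡0 a (subst (a * a ≤_) N≡0 (p²≤p²+q² a b)))
    (p²≤0⇒p≡0 b (subst (b * b ≤_) N≡0 (q²≤p²+q² a b))))

-- Underdetermined homogeneous systems

-- Vectors are functions, and functions with equal values need not be propositionally equal;
-- `respects` takes the place of extensionality.
record IsLinear {I : Set} (φ : (I → ℚ[i]) → ℚ[i]) : Set where
  field
    respects    : ∀ {x y} → (∀ i → x i ≡ y i) → φ x ≡ φ y
    additive    : ∀ x y → φ (λ i → x i +ᶜ y i) ≡ φ x +ᶜ φ y
    homogeneous : ∀ c x → φ (λ i → c *ᶜ x i) ≡ c *ᶜ φ x

open IsLinear

coordinate-isLinear : ∀ {I} (i : I) → IsLinear (λ x → x i)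
coordinate-isLinear i = record
  { respects = λ eq → eq i ; additive = λ _ _ → refl ; homogeneous = λ _ _ → refl }

scale-isLinear : ∀ {I} {φ : (I → ℚ[i]) → ℚ[i]} c → IsLinear φ → IsLinear (λ x → c *ᶜ φ x)
scale-isLinear {φ = φ} c l = record
  { respects    = λ eq → cong (c *ᶜ_) (respects l eq)
  ; additive    = λ x y → trans (cong (c *ᶜ_) (additive l x y)) (ℂᵣ.distribˡ c (φ x) (φ y))
  ; homogeneous = λ a x → trans (cong (c *ᶜ_) (homogeneous l a x))
      (solve 3 (λ a c z → c :* (a :* z) := a :* (c :* z)) refl a c (φ x))
  }
  where open ℂ-Solver

sub-isLinear : ∀ {I} {φ ψ : (I → ℚ[i]) → ℚ[i]} → IsLinear φ → IsLinear ψ → IsLinear (λ x → φ x -ᶜ ψ x)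
sub-isLinear {φ = φ} {ψ} l l′ = record
  { respects    = λ eq → cong₂ _-ᶜ_ (respects l eq) (respects l′ eq)
  ; additive    = λ x y → trans (cong₂ _-ᶜ_ (additive l x y) (additive l′ x y))
      (solve 4 (λ a b c d → (a :+ b) :- (c :+ d) := (a :- c) :+ (b :- d)) refl (φ x) (φ y) (ψ x) (ψ y))
  ; homogeneous = λ a x → trans (cong₂ _-ᶜ_ (homogeneous l a x) (homogeneous l′ a x))
      (solve 3 (λ a z w → a :* z :- a :* w := a :* (z :- w)) refl a (φ x) (ψ x))
  }
  where open ℂ-Solver

sum-isLinear : ∀ {I n} {φ : Fin n → (I → ℚ[i]) → ℚ[i]} →
               (∀ j → IsLinear (φ j)) → IsLinear (λ x → ∑[ j < n ] φ j x)
sum-isLinear {φ = φ} l = record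
  { respects    = λ eq → sum-cong-≗ (λ j → respects (l j) eq)
  ; additive    = λ x y → trans (sum-cong-≗ (λ j → additive (l j) x y)) (∑-distrib-+ (λ j → φ j x) (λ j → φ j y))
  ; homogeneous = λ c x → trans (sum-cong-≗ (λ j → homogeneous (l j) c x)) (sym (*-distribˡ-sum c (λ j → φ j x)))
  }

linear-0 : ∀ {I} {φ : (I → ℚ[i]) → ℚ[i]} → IsLinear φ → φ (λ _ → 0ᶜ) ≡ 0ᶜ
linear-0 {φ = φ} l = begin
  φ (λ _ → 0ᶜ)           ≡⟨ respects l (λ _ → sym (ℂᵣ.zeroˡ 0ᶜ)) ⟩
  φ (λ _ → 0ᶜ *ᶜ 0ᶜ)     ≡⟨ homogeneous l 0ᶜ (λ _ → 0ᶜ) ⟩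
  0ᶜ *ᶜ φ (λ _ → 0ᶜ)     ≡⟨ ℂᵣ.zeroˡ (φ (λ _ → 0ᶜ)) ⟩
  0ᶜ                     ∎
  where open ≡-Reasoning

linear-sum : ∀ {I n} {φ : (I → ℚ[i]) → ℚ[i]} → IsLinear φ → (f : Fin n → I → ℚ[i]) →
             φ (λ i → ∑[ p < n ] f p i) ≡ ∑[ p < n ] φ (f p)
linear-sum {n = zero}      l f = linear-0 l
linear-sum {n = suc n} {φ} l f =
  trans (additive l (f zero) (λ i → ∑[ p < n ] f (suc p) i)) (cong (φ (f zero) +ᶜ_) (linear-sum l (f ∘ suc)))

linear-sub : ∀ {I} {φ : (I → ℚ[i]) → ℚ[i]} → IsLinear φ → ∀ x y →
             φ (λ i → x i -ᶜ y i) ≡ φ x -ᶜ φ y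
linear-sub {φ = φ} l x y = begin
  φ (λ i → x i -ᶜ y i)                      ≡⟨ respects l (λ i → solve 2 (λ z w → z :- w := z :+ (:- con 1ᶜ) :* w) refl (x i) (y i)) ⟩
  φ (λ i → x i +ᶜ (-ᶜ 1ᶜ) *ᶜ y i)           ≡⟨ additive l x (λ i → (-ᶜ 1ᶜ) *ᶜ y i) ⟩
  φ x +ᶜ φ (λ i → (-ᶜ 1ᶜ) *ᶜ y i)           ≡⟨ cong (φ x +ᶜ_) (homogeneous l (-ᶜ 1ᶜ) y) ⟩
  φ x +ᶜ (-ᶜ 1ᶜ) *ᶜ φ y                     ≡⟨ solve 2 (λ z w → z :+ (:- con 1ᶜ) :* w := z :- w) refl (φ x) (φ y) ⟩
  φ x -ᶜ φ y                                ∎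
  where
  open ≡-Reasoning
  open ℂ-Solver

pullback-isLinear : ∀ {I J} {φ : (I → ℚ[i]) → ℚ[i]} (f : I → J) → IsLinear φ → IsLinear (λ x → φ (x ∘ f))
pullback-isLinear f l = record
  { respects = λ eq → respects l (eq ∘ f)
  ; additive = λ x y → additive l (x ∘ f) (y ∘ f)
  ; homogeneous = λ c x → homogeneous l c (x ∘ f) }

extend-isLinear : ∀ {n} {φ : (Fin (suc n) → ℚ[i]) → ℚ[i]} → IsLinear φ → IsLinear (λ x → φ (0ᶜ ∷ x))
extend-isLinear {φ = φ} l = record
  { respects    = λ eq → respects l λ { zero → refl ; (suc i) → eq i }
  ; additive    = λ x y → trans (respects l λ { zero → refl ; (suc i) → refl }) (additive l (0ᶜ ∷ x) (0ᶜ ∷ y))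
  ; homogeneous = λ c x → trans (respects l λ { zero → sym (ℂᵣ.zeroʳ c) ; (suc i) → refl }) (homogeneous l c (0ᶜ ∷ x))
  }

unit : ∀ {n} → Fin (suc n) → ℚ[i]
unit = 1ᶜ ∷ λ _ → 0ᶜ

-- The trial solutions in `kernel` have this shape: the head is chosen to cancel the pivot equation,
-- and the tail is scaled by the pivot.
linear-∷ : ∀ {n} {φ : (Fin (suc n) → ℚ[i]) → ℚ[i]} → IsLinear φ →
           ∀ c d x → φ (c ∷ λ i → d *ᶜ x i) ≡ c *ᶜ φ unit +ᶜ d *ᶜ φ (0ᶜ ∷ x)
linear-∷ {φ = φ} l c d x = begin
  φ (c ∷ λ i → d *ᶜ x i)
    ≡⟨ respects l (λ { zero → solve 2 (λ c d → c := c :* con 1ᶜ :+ d :* con 0ᶜ) refl c d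
                     ; (suc i) → solve 3 (λ c d z → d :* z := c :* con 0ᶜ :+ d :* z) refl c d (x i) }) ⟩
  φ (λ i → c *ᶜ unit i +ᶜ d *ᶜ (0ᶜ ∷ x) i)
    ≡⟨ additive l _ _ ⟩
  φ (λ i → c *ᶜ unit i) +ᶜ φ (λ i → d *ᶜ (0ᶜ ∷ x) i)
    ≡⟨ cong₂ _+ᶜ_ (homogeneous l c unit) (homogeneous l d (0ᶜ ∷ x)) ⟩
  c *ᶜ φ unit +ᶜ d *ᶜ φ (0ᶜ ∷ x) ∎
  where
  open ≡-Reasoning
  open ℂ-Solver

-- Separates one distinguished index from the others: the pivot equation in `kernel`, the trivial
-- minor in `proportional`.
punchIn-elim : ∀ {n} (P : Fin (suc n) → Set) i → P i → (∀ k → P (punchIn i k)) → ∀ j → P j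
punchIn-elim P i pᵢ p j with i Fin.≟ j
... | yes refl = pᵢ
... | no  i≢j  = subst P (Fin.punchIn-punchOut i≢j) (p (Fin.punchOut i≢j))

-- Gaussian elimination without division: a solution of the reduced system is scaled by the pivot.
kernel : ∀ {p n} → p ℕ.< n → (φ : Fin p → (Fin n → ℚ[i]) → ℚ[i]) → (∀ q → IsLinear (φ q)) →
         ∃[ x ] ((∃[ i ] x i ≢ 0ᶜ) × (∀ q → φ q x ≡ 0ᶜ))
kernel {p} {suc n} p<n φ l with Fin.any? (λ q → ¬? (φ q unit ≟ᶜ 0ᶜ))
-- Without a pivot in the first column, the first unit vector solves the system. The recursion ends
-- here, because an empty system has no pivot.
... | no none = unit , (zero , λ ()) , λ q → decidable-stable (φ q unit ≟ᶜ 0ᶜ) (λ φq≢0 → none (q , φq≢0))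
kernel {suc p} {suc n} (ℕ.s≤s p<n) φ l | yes (q , φq≢0) =
  let y , (i , yᵢ≢0) , sol = kernel p<n ψ ψ-isLinear
  in x y , (suc i , λ eq → yᵢ≢0 (*ᶜ-zero-divisor φq≢0 eq)) ,
     punchIn-elim (λ k → φ k (x y) ≡ 0ᶜ) q (pivot y) (λ k → trans (other y k) (sol k))
  where
  open ℂ-Solver
  c = φ q unit
  x : (Fin n → ℚ[i]) → Fin (suc n) → ℚ[i]
  x y = (-ᶜ φ q (0ᶜ ∷ y)) ∷ λ j → c *ᶜ y j
  ψ : Fin p → (Fin n → ℚ[i]) → ℚ[i]
  -- Cross-multiplication with the pivot equation: `ψ k y` is the value of the remaining functional
  -- at `x y`, as `other` verifies.
  ψ k y = c *ᶜ φ (punchIn q k) (0ᶜ ∷ y) -ᶜ φ (punchIn q k) unit *ᶜ φ q (0ᶜ ∷ y)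
  ψ-isLinear : ∀ k → IsLinear (ψ k)
  ψ-isLinear k = sub-isLinear (scale-isLinear c (extend-isLinear (l (punchIn q k))))
                              (scale-isLinear (φ (punchIn q k) unit) (extend-isLinear (l q)))
  pivot : ∀ y → φ q (x y) ≡ 0ᶜ
  pivot y = trans (linear-∷ (l q) (-ᶜ φ q (0ᶜ ∷ y)) c y)
    (solve 2 (λ b c → (:- b) :* c :+ c :* b := con 0ᶜ) refl (φ q (0ᶜ ∷ y)) c)
  other : ∀ y k → φ (punchIn q k) (x y) ≡ ψ k y
  other y k = trans (linear-∷ (l (punchIn q k)) (-ᶜ φ q (0ᶜ ∷ y)) c y)
    (solve 4 (λ b c d e → (:- b) :* d :+ c :* e := c :* e :- d :* b) refl
      (φ q (0ᶜ ∷ y)) c (φ (punchIn q k) unit) (φ (punchIn q k) (0ᶜ ∷ y)))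

z-w≡0⇒z≡w : ∀ {z w} → z -ᶜ w ≡ 0ᶜ → z ≡ w
z-w≡0⇒z≡w {z} {w} eq = trans (solve 2 (λ z w → z := (z :- w) :+ w) refl z w)
  (trans (cong (_+ᶜ w) eq) (ℂᵣ.+-identityˡ w))
  where open ℂ-Solver

-- Proportionality to μ costs d linear conditions, although there are more 2 × 2 minors when d ≥ 2.
proportional : ∀ {d} (μ : Fin (suc d) → ℚ[i]) → ∃[ i ] (∀ (ξ : Fin (suc d) → ℚ[i]) →
  (∀ e → μ i *ᶜ ξ (punchIn i e) -ᶜ μ (punchIn i e) *ᶜ ξ i ≡ 0ᶜ) →
  ∀ j k → μ k *ᶜ ξ j ≡ μ j *ᶜ ξ k)
proportional μ with Fin.any? (λ i → ¬? (μ i ≟ᶜ 0ᶜ))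
... | no none = zero , λ ξ _ j k → trans (cong (_*ᶜ ξ j) (μ≡0 k))
    (trans (solve 2 (λ a b → con 0ᶜ :* a := con 0ᶜ :* b) refl (ξ j) (ξ k)) (cong (_*ᶜ ξ k) (sym (μ≡0 j))))
  where
  open ℂ-Solver
  μ≡0 : ∀ i → μ i ≡ 0ᶜ
  μ≡0 i = decidable-stable (μ i ≟ᶜ 0ᶜ) (λ μᵢ≢0 → none (i , μᵢ≢0))
... | yes (i , μᵢ≢0) = i , λ ξ eqs j k →
  let minor = punchIn-elim (λ j → μ i *ᶜ ξ j -ᶜ μ j *ᶜ ξ i ≡ 0ᶜ) i (ℂᵣ.-‿inverseʳ (μ i *ᶜ ξ i)) eqs
  in  z-w≡0⇒z≡w (*ᶜ-zero-divisor μᵢ≢0 (trans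
        -- `μ i` times the minor of columns j and k is a combination of the minors that involve
        -- column i, and these vanish.
        (solve 6 (λ a b c x y z → a :* (c :* y :- b :* z) := c :* (a :* y :- b :* x) :- b :* (a :* z :- c :* x)) refl
           (μ i) (μ j) (μ k) (ξ i) (ξ j) (ξ k))
        (trans (cong₂ (λ s t → μ k *ᶜ s -ᶜ μ j *ᶜ t) (minor j) (minor k))
          (solve 2 (λ a b → a :* con 0ᶜ :- b :* con 0ᶜ := con 0ᶜ) refl (μ k) (μ j)))))
  where open ℂ-Solver

-- Koszul flattening

module _ {m : ℕ} where

  -- The pairing is bilinear, without conjugation: it evaluates the second tensor factor as a
  -- functional on x.
  pair : (Index m → ℚ[i]) → (Index m → ℚ[i]) → ℚ[i]
  pair v x = ∑[ b₁ < m ] ∑[ b₂ < m ] v (b₁ , b₂) *ᶜ x (b₁ , b₂)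

  pair-isLinear : ∀ v → IsLinear (pair v)
  pair-isLinear v = sum-isLinear λ b₁ → sum-isLinear λ b₂ → scale-isLinear (v (b₁ , b₂)) (coordinate-isLinear (b₁ , b₂))

  -- The first factor is contracted with the matrix Σ d i |i, τ i⟩, the second with x.
  contract : (Fin m → ℚ[i]) → (Fin m → Fin m) → (Index m → ℚ[i]) → Index m →
             (Index m × Index m × Index m → ℚ[i]) → ℚ[i]
  contract d τ x c t = ∑[ b₁ < m ] ∑[ b₂ < m ] ∑[ i < m ] (d i *ᶜ x (b₁ , b₂)) *ᶜ t ((i , τ i) , (b₁ , b₂) , c)

  contract-isLinear : ∀ d τ x c → IsLinear (contract d τ x c)
  contract-isLinear d τ x c = sum-isLinear λ b₁ → sum-isLinear λ b₂ → sum-isLinear λ i →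
    scale-isLinear (d i *ᶜ x (b₁ , b₂)) (coordinate-isLinear ((i , τ i) , (b₁ , b₂) , c))

  rankOne : (u v w : Index m → ℚ[i]) → Index m × Index m × Index m → ℚ[i]
  rankOne u v w (a , b , c) = u a *ᶜ v b *ᶜ w c

  -- This is the trace of u times the transpose of the matrix encoded by d and τ, which is the value
  -- left by contracting the first factor.
  trace : (Fin m → ℚ[i]) → (Fin m → Fin m) → (Index m → ℚ[i]) → ℚ[i]
  trace d τ u = ∑[ i < m ] d i *ᶜ u (i , τ i)

  contract-rankOne : ∀ d τ x c u v w →
    contract d τ x c (rankOne u v w) ≡ trace d τ u *ᶜ pair v x *ᶜ w c
  contract-rankOne d τ x c u v w = begin
    contract d τ x c (rankOne u v w)
      ≡⟨ (sum-cong-≗ λ b₁ → sum-cong-≗ λ b₂ → inner (b₁ , b₂)) ⟩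
    (∑[ b₁ < m ] ∑[ b₂ < m ] (v (b₁ , b₂) *ᶜ x (b₁ , b₂)) *ᶜ (μ *ᶜ w c))
      ≡⟨ (sum-cong-≗ λ b₁ → sym (*-distribʳ-sum (μ *ᶜ w c) λ b₂ → v (b₁ , b₂) *ᶜ x (b₁ , b₂))) ⟩
    (∑[ b₁ < m ] (∑[ b₂ < m ] v (b₁ , b₂) *ᶜ x (b₁ , b₂)) *ᶜ (μ *ᶜ w c))
      ≡⟨ sym (*-distribʳ-sum (μ *ᶜ w c) λ b₁ → ∑[ b₂ < m ] v (b₁ , b₂) *ᶜ x (b₁ , b₂)) ⟩
    pair v x *ᶜ (μ *ᶜ w c)
      ≡⟨ solve 3 (λ a b c → b :* (a :* c) := a :* b :* c) refl μ (pair v x) (w c) ⟩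
    μ *ᶜ pair v x *ᶜ w c ∎
    where
    open ≡-Reasoning
    open ℂ-Solver
    μ = trace d τ u
    inner : ∀ b → (∑[ i < m ] (d i *ᶜ x b) *ᶜ (u (i , τ i) *ᶜ v b *ᶜ w c)) ≡ (v b *ᶜ x b) *ᶜ (μ *ᶜ w c)
    inner b = begin
      (∑[ i < m ] (d i *ᶜ x b) *ᶜ (u (i , τ i) *ᶜ v b *ᶜ w c))
        ≡⟨ (sum-cong-≗ λ i → solve 5 (λ d x u v w → (d :* x) :* (u :* v :* w) := (d :* u) :* (v :* x :* w)) refl
              (d i) (x b) (u (i , τ i)) (v b) (w c)) ⟩
      (∑[ i < m ] (d i *ᶜ u (i , τ i)) *ᶜ (v b *ᶜ x b *ᶜ w c))
        ≡⟨ sym (*-distribʳ-sum (v b *ᶜ x b *ᶜ w c) λ i → d i *ᶜ u (i , τ i)) ⟩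
      μ *ᶜ (v b *ᶜ x b *ᶜ w c)
        ≡⟨ solve 3 (λ a b c → a :* (b :* c) := b :* (a :* c)) refl μ (v b *ᶜ x b) (w c) ⟩
      (v b *ᶜ x b) *ᶜ (μ *ᶜ w c) ∎

  rankSum : ∀ {s} (u v w : Fin s → Index m → ℚ[i]) → Index m × Index m × Index m → ℚ[i]
  rankSum {s} u v w abc = ∑[ p < s ] rankOne (u p) (v p) (w p) abc

  -- A summand contributes `μ p k *ᶜ pair (v p) (x j) *ᶜ w p c`, which is symmetric in j and k once
  -- the pairings are proportional to `μ p`. Since `proportional` asks for two equations per
  -- summand, there are 2s equations in 3m² unknowns.
  koszul-kernel : ∀ {s} → s ℕ.* 2 ℕ.< 3 ℕ.* (m ℕ.* m) → (d : Fin 3 → Fin m → ℚ[i]) (τ : Fin 3 → Fin m → Fin m) →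
    (u v w : Fin s → Index m → ℚ[i]) →
    ∃ λ (x : Fin 3 → Index m → ℚ[i]) → (∃₂ λ j b → x j b ≢ 0ᶜ) ×
      (∀ j k c → contract (d k) (τ k) (x j) c (rankSum u v w) ≡ contract (d j) (τ j) (x k) c (rankSum u v w))
  koszul-kernel {s} 2s<3m² d τ u v w =
    let y , (n , yₙ≢0) , sol = kernel 2s<3m² (φ ∘ remQuot 2) (φ-isLinear ∘ remQuot 2)
        x = unflatten y
        j , b₁ , b₂ = decode n
    in x , (j , (b₁ , b₂) , λ eq → yₙ≢0 (trans (cong y (sym (encode-decode n))) eq)) ,
       λ j k c → symmetric x (λ p e → trans (sym (cong (λ pe → φ pe y) (Fin.remQuot-combine p e))) (sol (combine p e))) j k c
    where
    decode : Fin (3 ℕ.* (m ℕ.* m)) → Fin 3 × Fin m × Fin m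
    decode n = proj₁ (remQuot {3} (m ℕ.* m) n) , remQuot {m} m (proj₂ (remQuot {3} (m ℕ.* m) n))
    encode-decode : ∀ n → combine (proj₁ (decode n)) (combine (proj₁ (proj₂ (decode n))) (proj₂ (proj₂ (decode n)))) ≡ n
    encode-decode n = trans (cong (combine (proj₁ (decode n))) (Fin.combine-remQuot {m} m (proj₂ (remQuot {3} (m ℕ.* m) n))))
                            (Fin.combine-remQuot {3} (m ℕ.* m) n)
    unflatten : (Fin (3 ℕ.* (m ℕ.* m)) → ℚ[i]) → Fin 3 → Index m → ℚ[i]
    unflatten y j (b₁ , b₂) = y (combine j (combine b₁ b₂))
    μ : Fin s → Fin 3 → ℚ[i]
    μ p k = trace (d k) (τ k) (u p)
    -- The index is determined by the fixed values `μ p` and not by the unknowns, so the equations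
    -- `φ` are linear.
    i₀ : Fin s → Fin 3
    i₀ p = proj₁ (proportional (μ p))
    φ : Fin s × Fin 2 → (Fin (3 ℕ.* (m ℕ.* m)) → ℚ[i]) → ℚ[i]
    φ (p , e) y = μ p (i₀ p) *ᶜ pair (v p) (unflatten y (punchIn (i₀ p) e))
               -ᶜ μ p (punchIn (i₀ p) e) *ᶜ pair (v p) (unflatten y (i₀ p))
    ξ-isLinear : ∀ p j → IsLinear (λ y → pair (v p) (unflatten y j))
    ξ-isLinear p j = pullback-isLinear (λ (b₁ , b₂) → combine j (combine b₁ b₂)) (pair-isLinear (v p))
    φ-isLinear : ∀ pe → IsLinear (φ pe)
    φ-isLinear (p , e) = sub-isLinear (scale-isLinear (μ p (i₀ p)) (ξ-isLinear p (punchIn (i₀ p) e)))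
                                      (scale-isLinear (μ p (punchIn (i₀ p) e)) (ξ-isLinear p (i₀ p)))
    contract-rankSum : ∀ d τ x c → contract d τ x c (rankSum u v w) ≡ ∑[ p < s ] trace d τ (u p) *ᶜ pair (v p) x *ᶜ w p c
    contract-rankSum d τ x c = trans (linear-sum (contract-isLinear d τ x c) (λ p → rankOne (u p) (v p) (w p)))
      (sum-cong-≗ λ p → contract-rankOne d τ x c (u p) (v p) (w p))
    symmetric : ∀ (x : Fin 3 → Index m → ℚ[i]) →
      (∀ p e → μ p (i₀ p) *ᶜ pair (v p) (x (punchIn (i₀ p) e)) -ᶜ μ p (punchIn (i₀ p) e) *ᶜ pair (v p) (x (i₀ p)) ≡ 0ᶜ) →
      ∀ j k c → contract (d k) (τ k) (x j) c (rankSum u v w) ≡ contract (d j) (τ j) (x k) c (rankSum u v w)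
    symmetric x eqs j k c = begin
      contract (d k) (τ k) (x j) c (rankSum u v w)
        ≡⟨ contract-rankSum (d k) (τ k) (x j) c ⟩
      (∑[ p < s ] μ p k *ᶜ pair (v p) (x j) *ᶜ w p c)
        ≡⟨ (sum-cong-≗ λ p → cong (_*ᶜ w p c) (proj₂ (proportional (μ p)) (λ j → pair (v p) (x j)) (eqs p) j k)) ⟩
      (∑[ p < s ] μ p j *ᶜ pair (v p) (x k) *ᶜ w p c)
        ≡⟨ sym (contract-rankSum (d j) (τ j) (x k) c) ⟩
      contract (d j) (τ j) (x k) c (rankSum u v w) ∎
      where open ≡-Reasoning

-- The matrix multiplication tensor

δ : ∀ {n} → Fin n → Fin n → ℚ[i]
δ i j = if does (i Fin.≟ j) then 1ᶜ else 0ᶜ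

δ-sym : ∀ {n} (i j : Fin n) → δ i j ≡ δ j i
δ-sym zero    zero    = refl
δ-sym zero    (suc j) = refl
δ-sym (suc i) zero    = refl
δ-sym (suc i) (suc j) = δ-sym i j

∑-δ : ∀ {n} (f : Fin n → ℚ[i]) j → (∑[ i < n ] f i *ᶜ δ i j) ≡ f j
∑-δ {suc n} f zero = begin
  f zero *ᶜ 1ᶜ +ᶜ (∑[ i < n ] f (suc i) *ᶜ 0ᶜ)
    ≡⟨ cong₂ _+ᶜ_ (ℂᵣ.*-identityʳ (f zero)) (trans (sum-cong-≗ λ i → ℂᵣ.zeroʳ (f (suc i))) (sum-replicate-zero n)) ⟩
  f zero +ᶜ 0ᶜ
    ≡⟨ ℂᵣ.+-identityʳ (f zero) ⟩
  f zero ∎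
  where open ≡-Reasoning
∑-δ {suc n} f (suc j) = begin
  f zero *ᶜ 0ᶜ +ᶜ (∑[ i < n ] f (suc i) *ᶜ δ i j)
    ≡⟨ cong₂ _+ᶜ_ (ℂᵣ.zeroʳ (f zero)) (∑-δ (f ∘ suc) j) ⟩
  0ᶜ +ᶜ f (suc j)
    ≡⟨ ℂᵣ.+-identityˡ (f (suc j)) ⟩
  f (suc j) ∎
  where open ≡-Reasoning

∑-δʳ : ∀ {n} (f : Fin n → ℚ[i]) j → (∑[ i < n ] f i *ᶜ δ j i) ≡ f j
∑-δʳ f j = trans (sum-cong-≗ λ i → cong (f i *ᶜ_) (δ-sym j i)) (∑-δ f j)

module _ {m : ℕ} where

  basis : Index m → Index m → ℚ[i]
  basis a b = if does (≡-dec Fin._≟_ Fin._≟_ b a) then 1ᶜ else 0ᶜ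

  basis-δ : ∀ i j k l → basis (i , j) (k , l) ≡ δ k i *ᶜ δ l j
  basis-δ i j k l with k Fin.≟ i
  ... | no  _    = sym (ℂᵣ.zeroˡ (δ l j))
  ... | yes refl = sym (ℂᵣ.*-identityˡ (δ l j))

  -- Sums and products are nested as in `𝓜`, so that `𝓜-at` can compare the two term by term.
  matMul : Index m × Index m × Index m → ℚ[i]
  matMul abc = ∑[ i < m ] ∑[ j < m ] ∑[ l < m ] rankOne (basis (i , j)) (basis (j , l)) (basis (l , i)) abc

  trace-basis : ∀ d τ i j → trace d τ (basis (i , j)) ≡ d i *ᶜ δ (τ i) j
  trace-basis d τ i j = trans
    (sum-cong-≗ λ k → trans (cong (d k *ᶜ_) (basis-δ i j k (τ k)))
      (solve 3 (λ d a b → d :* (a :* b) := d :* b :* a) refl (d k) (δ k i) (δ (τ k) j)))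
    (∑-δ (λ k → d k *ᶜ δ (τ k) j) i)
    where open ℂ-Solver

  pair-basis : ∀ x j l → pair (basis (j , l)) x ≡ x (j , l)
  pair-basis x j l = trans
    (sum-cong-≗ λ b₁ → trans
      (sum-cong-≗ λ b₂ → trans (cong (_*ᶜ x (b₁ , b₂)) (basis-δ j l b₁ b₂))
        (solve 3 (λ x a b → a :* b :* x := x :* a :* b) refl (x (b₁ , b₂)) (δ b₁ j) (δ b₂ l)))
      (∑-δ (λ b₂ → x (b₁ , b₂) *ᶜ δ b₁ j) l))
    (∑-δ (λ b₁ → x (b₁ , l)) j)
    where open ℂ-Solver

  -- Contraction turns the tensor into left multiplication by the matrix A with entries d i in
  -- positions (i, τ i): the right-hand side is the entry (i, l) of A x. The third factor carries
  -- its indices in the order (l, i).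
  contract-matMul : ∀ d τ x l i → contract d τ x (l , i) matMul ≡ d i *ᶜ x (τ i , l)
  contract-matMul d τ x l′ i′ = begin
    φ matMul
      ≡⟨ linear-sum φ-lin (λ i abc → ∑[ j < m ] ∑[ l < m ] E i j l abc) ⟩
    (∑[ i < m ] φ (λ abc → ∑[ j < m ] ∑[ l < m ] E i j l abc))
      ≡⟨ (sum-cong-≗ λ i → linear-sum φ-lin (λ j abc → ∑[ l < m ] E i j l abc)) ⟩
    (∑[ i < m ] ∑[ j < m ] φ (λ abc → ∑[ l < m ] E i j l abc))
      ≡⟨ (sum-cong-≗ λ i → sum-cong-≗ λ j → linear-sum φ-lin (E i j)) ⟩
    (∑[ i < m ] ∑[ j < m ] ∑[ l < m ] φ (E i j l))
      ≡⟨ (sum-cong-≗ λ i → sum-cong-≗ λ j → sum-cong-≗ λ l → term i j l) ⟩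
    (∑[ i < m ] ∑[ j < m ] ∑[ l < m ] d i *ᶜ x (j , l) *ᶜ δ i′ i *ᶜ δ (τ i) j *ᶜ δ l′ l)
      ≡⟨ (sum-cong-≗ λ i → sum-cong-≗ λ j → ∑-δʳ (λ l → d i *ᶜ x (j , l) *ᶜ δ i′ i *ᶜ δ (τ i) j) l′) ⟩
    (∑[ i < m ] ∑[ j < m ] d i *ᶜ x (j , l′) *ᶜ δ i′ i *ᶜ δ (τ i) j)
      ≡⟨ (sum-cong-≗ λ i → ∑-δʳ (λ j → d i *ᶜ x (j , l′) *ᶜ δ i′ i) (τ i)) ⟩
    (∑[ i < m ] d i *ᶜ x (τ i , l′) *ᶜ δ i′ i)
      ≡⟨ ∑-δʳ (λ i → d i *ᶜ x (τ i , l′)) i′ ⟩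
    d i′ *ᶜ x (τ i′ , l′) ∎
    where
    open ≡-Reasoning
    φ = contract d τ x (l′ , i′)
    φ-lin = contract-isLinear d τ x (l′ , i′)
    E : Fin m → Fin m → Fin m → Index m × Index m × Index m → ℚ[i]
    E i j l = rankOne (basis (i , j)) (basis (j , l)) (basis (l , i))
    term : ∀ i j l → φ (E i j l) ≡ d i *ᶜ x (j , l) *ᶜ δ i′ i *ᶜ δ (τ i) j *ᶜ δ l′ l
    term i j l = begin
      φ (E i j l)
        ≡⟨ contract-rankOne d τ x (l′ , i′) (basis (i , j)) (basis (j , l)) (basis (l , i)) ⟩
      trace d τ (basis (i , j)) *ᶜ pair (basis (j , l)) x *ᶜ basis (l , i) (l′ , i′)
        ≡⟨ cong₂ _*ᶜ_ (cong₂ _*ᶜ_ (trace-basis d τ i j) (pair-basis x j l)) (basis-δ l i l′ i′) ⟩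
      d i *ᶜ δ (τ i) j *ᶜ x (j , l) *ᶜ (δ l′ l *ᶜ δ i′ i)
        ≡⟨ solve 5 (λ d a x b c → d :* a :* x :* (b :* c) := d :* x :* c :* a :* b) refl
             (d i) (δ (τ i) j) (x (j , l)) (δ l′ l) (δ i′ i) ⟩
      d i *ᶜ x (j , l) *ᶜ δ i′ i *ᶜ δ (τ i) j *ᶜ δ l′ l ∎
      where open ℂ-Solver

-- Norms

module ℚΣ = SemiringSum (CommutativeRing.semiring ℚ.+-*-commutativeRing)

∑-mono-≤ : ∀ {n} {f g : Fin n → ℚ} → (∀ i → f i ≤ g i) → ℚΣ.sum f ≤ ℚΣ.sum g
∑-mono-≤ {zero}  f≤g = ℚ.≤-refl
∑-mono-≤ {suc n} f≤g = ℚ.+-mono-≤ (f≤g zero) (∑-mono-≤ (f≤g ∘ suc))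

p≤p+q : ∀ {p q} → 0ℚ ≤ q → p ≤ p + q
p≤p+q {p} {q} 0≤q = subst (_≤ p + q) (ℚ.+-identityʳ p) (ℚ.+-monoʳ-≤ p 0≤q)

p≤q+p : ∀ {p q} → 0ℚ ≤ q → p ≤ q + p
p≤q+p {p} {q} 0≤q = subst (_≤ q + p) (ℚ.+-identityˡ p) (ℚ.+-monoˡ-≤ p 0≤q)

0≤∑ : ∀ {n} {f : Fin n → ℚ} → (∀ i → 0ℚ ≤ f i) → 0ℚ ≤ ℚΣ.sum f
0≤∑ {zero}  0≤f = ℚ.≤-refl
0≤∑ {suc n} 0≤f = ℚ.+-mono-≤ (0≤f zero) (0≤∑ (0≤f ∘ suc))

term≤∑ : ∀ {n} {f : Fin n → ℚ} → (∀ i → 0ℚ ≤ f i) → ∀ i → f i ≤ ℚΣ.sum f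
term≤∑ 0≤f zero    = p≤p+q (0≤∑ (0≤f ∘ suc))
term≤∑ 0≤f (suc i) = ℚ.≤-trans (term≤∑ (0≤f ∘ suc) i) (p≤q+p (0≤f zero))

*-mono-≤ : ∀ {p q r s} → 0ℚ ≤ r → 0ℚ ≤ q → p ≤ q → r ≤ s → p * r ≤ q * s
*-mono-≤ {p} {q} {r} {s} 0≤r 0≤q p≤q r≤s = ℚ.≤-trans
  (ℚ.*-monoʳ-≤-nonNeg r {{nonNegative 0≤r}} p≤q) (ℚ.*-monoˡ-≤-nonNeg q {{nonNegative 0≤q}} r≤s)

0≤* : ∀ {p q} → 0ℚ ≤ p → 0ℚ ≤ q → 0ℚ ≤ p * q
0≤* {p} {q} 0≤p 0≤q = subst (_≤ p * q) (ℚ.*-zeroˡ q) (ℚ.*-monoʳ-≤-nonNeg q {{nonNegative 0≤q}} 0≤p)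

-- Unlike the modulus, the sum of the absolute values of the parts is rational; it is still
-- submultiplicative.
‖_‖ : ℚ[i] → ℚ
‖ a +𝕚 b ‖ = ∣ a ∣ + ∣ b ∣

0≤‖z‖ : ∀ z → 0ℚ ≤ ‖ z ‖
0≤‖z‖ (a +𝕚 b) = ℚ.+-mono-≤ (ℚ.0≤∣p∣ a) (ℚ.0≤∣p∣ b)

‖-z‖ : ∀ z → ‖ -ᶜ z ‖ ≡ ‖ z ‖
‖-z‖ (a +𝕚 b) = cong₂ _+_ (ℚ.∣-p∣≡∣p∣ a) (ℚ.∣-p∣≡∣p∣ b)

‖z+w‖≤ : ∀ z w → ‖ z +ᶜ w ‖ ≤ ‖ z ‖ + ‖ w ‖
‖z+w‖≤ (a +𝕚 b) (c +𝕚 d) = subst (‖ (a +𝕚 b) +ᶜ (c +𝕚 d) ‖ ≤_)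
  (solve 4 (λ a b c d → (a :+ c) :+ (b :+ d) := (a :+ b) :+ (c :+ d)) refl (∣ a ∣) (∣ b ∣) (∣ c ∣) (∣ d ∣))
  (ℚ.+-mono-≤ (ℚ.∣p+q∣≤∣p∣+∣q∣ a c) (ℚ.∣p+q∣≤∣p∣+∣q∣ b d))
  where open +-*-Solver

‖z-w‖≤ : ∀ z w → ‖ z -ᶜ w ‖ ≤ ‖ z ‖ + ‖ w ‖
‖z-w‖≤ z w = subst (λ q → ‖ z -ᶜ w ‖ ≤ ‖ z ‖ + q) (‖-z‖ w) (‖z+w‖≤ z (-ᶜ w))

‖z*w‖≤ : ∀ z w → ‖ z *ᶜ w ‖ ≤ ‖ z ‖ * ‖ w ‖
‖z*w‖≤ (a +𝕚 b) (c +𝕚 d) = begin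
  ∣ a * c - b * d ∣ + ∣ a * d + b * c ∣
    ≤⟨ ℚ.+-mono-≤ (ℚ.∣p-q∣≤∣p∣+∣q∣ (a * c) (b * d)) (ℚ.∣p+q∣≤∣p∣+∣q∣ (a * d) (b * c)) ⟩
  (∣ a * c ∣ + ∣ b * d ∣) + (∣ a * d ∣ + ∣ b * c ∣)
    ≡⟨ cong₂ _+_ (cong₂ _+_ (ℚ.∣p*q∣≡∣p∣*∣q∣ a c) (ℚ.∣p*q∣≡∣p∣*∣q∣ b d))
                 (cong₂ _+_ (ℚ.∣p*q∣≡∣p∣*∣q∣ a d) (ℚ.∣p*q∣≡∣p∣*∣q∣ b c)) ⟩
  (∣ a ∣ * ∣ c ∣ + ∣ b ∣ * ∣ d ∣) + (∣ a ∣ * ∣ d ∣ + ∣ b ∣ * ∣ c ∣)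
    ≡⟨ solve 4 (λ a b c d → (a :* c :+ b :* d) :+ (a :* d :+ b :* c) := (a :+ b) :* (c :+ d)) refl
         (∣ a ∣) (∣ b ∣) (∣ c ∣) (∣ d ∣) ⟩
  (∣ a ∣ + ∣ b ∣) * (∣ c ∣ + ∣ d ∣) ∎
  where
  open ℚ.≤-Reasoning
  open +-*-Solver

‖∑‖≤ : ∀ {n} (f : Fin n → ℚ[i]) → ‖ sum f ‖ ≤ ℚΣ.sum (λ i → ‖ f i ‖)
‖∑‖≤ {zero}  f = ℚ.≤-refl
‖∑‖≤ {suc n} f = ℚ.≤-trans (‖z+w‖≤ (f zero) (sum (f ∘ suc))) (ℚ.+-monoʳ-≤ ‖ f zero ‖ (‖∑‖≤ (f ∘ suc)))

0<‖z‖ : ∀ {z} → z ≢ 0ᶜ → 0ℚ < ‖ z ‖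
0<‖z‖ {a +𝕚 b} z≢0 = ℚ.≰⇒> λ ‖z‖≤0 → z≢0 (cong₂ _+𝕚_
  (vanish a (ℚ.≤-trans (p≤p+q (ℚ.0≤∣p∣ b)) ‖z‖≤0))
  (vanish b (ℚ.≤-trans (p≤q+p (ℚ.0≤∣p∣ a)) ‖z‖≤0)))
  where
  vanish : ∀ p → ∣ p ∣ ≤ 0ℚ → p ≡ 0ℚ
  vanish p ∣p∣≤0 = ℚ.∣p∣≡0⇒p≡0 p (ℚ.≤-antisym ∣p∣≤0 (ℚ.0≤∣p∣ p))

real : ℚ → ℚ[i]
real p = p +𝕚 0ℚ

-- For a real factor submultiplicativity is an equality, which allows lower bounds as well.
‖real-*‖ : ∀ p z → ‖ real p *ᶜ z ‖ ≡ ∣ p ∣ * ‖ z ‖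
‖real-*‖ p (a +𝕚 b) = begin
  ∣ p * a - 0ℚ * b ∣ + ∣ p * b + 0ℚ * a ∣
    ≡⟨ cong₂ (λ x y → ∣ x ∣ + ∣ y ∣)
         (solve 3 (λ p a b → p :* a :- con 0ℚ :* b := p :* a) refl p a b)
         (solve 3 (λ p a b → p :* b :+ con 0ℚ :* a := p :* b) refl p a b) ⟩
  ∣ p * a ∣ + ∣ p * b ∣
    ≡⟨ cong₂ _+_ (ℚ.∣p*q∣≡∣p∣*∣q∣ p a) (ℚ.∣p*q∣≡∣p∣*∣q∣ p b) ⟩
  ∣ p ∣ * ∣ a ∣ + ∣ p ∣ * ∣ b ∣
    ≡⟨ ℚ.*-distribˡ-+ (∣ p ∣) (∣ a ∣) (∣ b ∣) ⟨
  ∣ p ∣ * (∣ a ∣ + ∣ b ∣) ∎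
  where
  open ≡-Reasoning
  open +-*-Solver

‖z‖≤‖real-*‖ : ∀ {p} z → 1ℚ ≤ ∣ p ∣ → ‖ z ‖ ≤ ‖ real p *ᶜ z ‖
‖z‖≤‖real-*‖ {p} z 1≤∣p∣ = begin
  ‖ z ‖            ≡⟨ ℚ.*-identityˡ ‖ z ‖ ⟨
  1ℚ * ‖ z ‖       ≤⟨ ℚ.*-monoʳ-≤-nonNeg ‖ z ‖ {{nonNegative (0≤‖z‖ z)}} 1≤∣p∣ ⟩
  ∣ p ∣ * ‖ z ‖    ≡⟨ ‖real-*‖ p z ⟨
  ‖ real p *ᶜ z ‖  ∎
  where open ℚ.≤-Reasoning

‖_‖₁ : ∀ {n} → (Fin n → ℚ[i]) → ℚ
‖ d ‖₁ = ℚΣ.sum (λ i → ‖ d i ‖)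

‖_‖ᴹ : ∀ {m} → (Index m → ℚ[i]) → ℚ
‖_‖ᴹ x = ℚΣ.sum (λ b₁ → ‖ (λ b₂ → x (b₁ , b₂)) ‖₁)

0≤‖d‖₁ : ∀ {n} (d : Fin n → ℚ[i]) → 0ℚ ≤ ‖ d ‖₁
0≤‖d‖₁ d = 0≤∑ (λ i → 0≤‖z‖ (d i))

0≤‖x‖ᴹ : ∀ {m} (x : Index m → ℚ[i]) → 0ℚ ≤ ‖ x ‖ᴹ
0≤‖x‖ᴹ x = 0≤∑ (λ b₁ → 0≤‖d‖₁ (λ b₂ → x (b₁ , b₂)))

entry≤‖x‖ᴹ : ∀ {m} (x : Index m → ℚ[i]) b → ‖ x b ‖ ≤ ‖ x ‖ᴹ
entry≤‖x‖ᴹ x (b₁ , b₂) = ℚ.≤-trans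
  (term≤∑ (λ b₂ → 0≤‖z‖ (x (b₁ , b₂))) b₂)
  (term≤∑ (λ b₁ → 0≤‖d‖₁ (λ b₂ → x (b₁ , b₂))) b₁)

-- The bound is linear in the norm of x, so that the error can later be absorbed however large the
-- kernel vector is.
contract-bound : ∀ {m} d τ (x : Index m → ℚ[i]) c t {ε} → 0ℚ ≤ ε → (∀ abc → ‖ t abc ‖ ≤ ε) →
                 ‖ contract d τ x c t ‖ ≤ ‖ d ‖₁ * (‖ x ‖ᴹ * ε)
contract-bound {m} d τ x c t {ε} 0≤ε t≤ε = begin
  ‖ contract d τ x c t ‖
    ≤⟨ ℚ.≤-trans (‖∑‖≤ {m} _) (∑-mono-≤ λ b₁ → ℚ.≤-trans (‖∑‖≤ {m} _) (∑-mono-≤ λ b₂ → inner b₁ b₂)) ⟩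
  ℚΣ.sum {m} (λ b₁ → ℚΣ.sum {m} λ b₂ → ‖ x (b₁ , b₂) ‖ * (‖ d ‖₁ * ε))
    ≡⟨ ℚΣ.sum-cong-≗ (λ b₁ → ℚΣ.*-distribʳ-sum (‖ d ‖₁ * ε) (λ b₂ → ‖ x (b₁ , b₂) ‖)) ⟨
  ℚΣ.sum {m} (λ b₁ → ‖ (λ b₂ → x (b₁ , b₂)) ‖₁ * (‖ d ‖₁ * ε))
    ≡⟨ ℚΣ.*-distribʳ-sum (‖ d ‖₁ * ε) (λ b₁ → ‖ (λ b₂ → x (b₁ , b₂)) ‖₁) ⟨
  ‖ x ‖ᴹ * (‖ d ‖₁ * ε)
    ≡⟨ solve 3 (λ x d e → x :* (d :* e) := d :* (x :* e)) refl ‖ x ‖ᴹ ‖ d ‖₁ ε ⟩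
  ‖ d ‖₁ * (‖ x ‖ᴹ * ε) ∎
  where
  open ℚ.≤-Reasoning
  open +-*-Solver
  inner : ∀ b₁ b₂ → ‖ (∑[ i < m ] (d i *ᶜ x (b₁ , b₂)) *ᶜ t ((i , τ i) , (b₁ , b₂) , c)) ‖
                    ≤ ‖ x (b₁ , b₂) ‖ * (‖ d ‖₁ * ε)
  inner b₁ b₂ = begin
    ‖ (∑[ i < m ] (d i *ᶜ x b) *ᶜ t ((i , τ i) , b , c)) ‖
      ≤⟨ ‖∑‖≤ {m} _ ⟩
    ℚΣ.sum {m} (λ i → ‖ (d i *ᶜ x b) *ᶜ t ((i , τ i) , b , c) ‖)
      ≤⟨ ∑-mono-≤ (λ i → ℚ.≤-trans (‖z*w‖≤ (d i *ᶜ x b) (t ((i , τ i) , b , c)))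
           (*-mono-≤ (0≤‖z‖ (t ((i , τ i) , b , c))) (0≤* (0≤‖z‖ (d i)) (0≤‖z‖ (x b)))
                     (‖z*w‖≤ (d i) (x b)) (t≤ε ((i , τ i) , b , c)))) ⟩
    ℚΣ.sum {m} (λ i → ‖ d i ‖ * ‖ x b ‖ * ε)
      ≡⟨ ℚΣ.sum-cong-≗ (λ i → ℚ.*-assoc ‖ d i ‖ ‖ x b ‖ ε) ⟩
    ℚΣ.sum {m} (λ i → ‖ d i ‖ * (‖ x b ‖ * ε))
      ≡⟨ ℚΣ.*-distribʳ-sum (‖ x b ‖ * ε) (λ i → ‖ d i ‖) ⟨
    ‖ d ‖₁ * (‖ x b ‖ * ε)
      ≡⟨ solve 3 (λ x d e → d :* (x :* e) := x :* (d :* e)) refl ‖ x b ‖ ‖ d ‖₁ ε ⟩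
    ‖ x b ‖ * (‖ d ‖₁ * ε) ∎
    where b = b₁ , b₂

small-multiplier : ∀ H → ∃[ ε ] (0ℚ < ε × H * ε < 1ℚ)
small-multiplier H = 1/ q , 0<ε , (begin-strict
  H * 1/ q        ≤⟨ ℚ.*-monoʳ-≤-nonNeg (1/ q) {{nonNegative (ℚ.<⇒≤ 0<ε)}} (p≤∣p∣ H) ⟩
  ∣ H ∣ * 1/ q    <⟨ ℚ.*-monoˡ-<-pos (1/ q) {{positive 0<ε}} (subst (_< q) (ℚ.+-identityˡ ∣ H ∣) (ℚ.+-monoˡ-< ∣ H ∣ (ℚ.positive⁻¹ 1ℚ))) ⟩
  q * 1/ q        ≡⟨ ℚ.*-inverseʳ q ⟩
  1ℚ              ∎)
  where
  open ℚ.≤-Reasoning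
  -- The summand 1 makes q invertible even for H = 0 and keeps `H * 1/ q` strictly below 1.
  q = 1ℚ + ∣ H ∣
  instance
    q-pos : Positive q
    q-pos = ℚ.pos+nonNeg⇒pos 1ℚ ∣ H ∣ {{ℚ.∣-∣-nonNeg H}}
    q-nonZero : NonZero q
    q-nonZero = ℚ.pos⇒nonZero q
  0<ε : 0ℚ < 1/ q
  0<ε = ℚ.positive⁻¹ (1/ q) {{ℚ.1/pos⇒pos q}}
  p≤∣p∣ : ∀ p → p ≤ ∣ p ∣
  p≤∣p∣ p with ℚ.≤-total 0ℚ p
  ... | inj₁ 0≤p = ℚ.≤-reflexive (sym (ℚ.0≤p⇒∣p∣≡p 0≤p))
  ... | inj₂ p≤0 = ℚ.≤-trans p≤0 (ℚ.0≤∣p∣ p)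

-- Three matrices with a nonsingular commutator

difference-bound : ∀ {y z} a b c {η} → y ≡ a -ᶜ c → z ≡ b -ᶜ c → ‖ y ‖ ≤ η → ‖ z ‖ ≤ η → ‖ a -ᶜ b ‖ ≤ η + η
difference-bound a b c {η} refl refl ac≤η bc≤η = subst (λ z → ‖ z ‖ ≤ η + η)
  (solve 3 (λ a b c → (a :- c) :- (b :- c) := a :- b) refl a b c)
  (ℚ.≤-trans (‖z-w‖≤ (a -ᶜ c) (b -ᶜ c)) (ℚ.+-mono-≤ ac≤η bc≤η))
  where open ℂ-Solver

-- Otherwise the positive norm X would be at most `H * (C + C) * ε` times itself, a factor below 1.
absorbing-bound : ∀ {H C X ε} → 0ℚ < X → H * (C + C) * ε < 1ℚ → ¬ (X ≤ H * (C * (X * ε) + C * (X * ε)))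
absorbing-bound {H} {C} {X} {ε} 0<X small X≤ = ℚ.<-irrefl refl (begin-strict
  X                                    ≤⟨ X≤ ⟩
  H * (C * (X * ε) + C * (X * ε))
    ≡⟨ solve 4 (λ H C X ε → H :* (C :* (X :* ε) :+ C :* (X :* ε)) := H :* (C :+ C) :* ε :* X) refl H C X ε ⟩
  H * (C + C) * ε * X                  <⟨ ℚ.*-monoˡ-<-pos X {{positive 0<X}} small ⟩
  1ℚ * X                               ≡⟨ ℚ.*-identityˡ X ⟩
  X                                    ∎)
  where
  open ℚ.≤-Reasoning
  open +-*-Solver

height : ∀ {n} → Fin n → ℚ
height zero    = 0ℚ
height (suc i) = 1ℚ + height i

0≤height : ∀ {n} (i : Fin n) → 0ℚ ≤ height i
0≤height zero    = ℚ.≤-refl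
0≤height (suc i) = ℚ.+-mono-≤ (ℚ.nonNegative⁻¹ 1ℚ) (0≤height i)

-- Heights are integers, so distinct ones are at least 1 apart. This bounds the nonzero entries of
-- the commutator away from zero, so inverting it does not enlarge the norm.
height-separated : ∀ {n} (i j : Fin n) → i ≢ j → 1ℚ ≤ ∣ height i - height j ∣
height-separated zero    zero    i≢j = contradiction refl i≢j
height-separated zero    (suc j) i≢j = subst (1ℚ ≤_)
  (trans (sym (ℚ.0≤p⇒∣p∣≡p (0≤height (suc j)))) (trans (sym (ℚ.∣-p∣≡∣p∣ (1ℚ + height j))) (cong ∣_∣ (sym (ℚ.+-identityˡ (- (1ℚ + height j)))))))
  (p≤p+q (0≤height j))
height-separated (suc i) zero    i≢j = subst (1ℚ ≤_)
  (trans (sym (ℚ.0≤p⇒∣p∣≡p (0≤height (suc i)))) (cong ∣_∣ (sym (ℚ.+-identityʳ (1ℚ + height i)))))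
  (p≤p+q (0≤height i))
height-separated (suc i) (suc j) i≢j = subst (λ q → 1ℚ ≤ ∣ q ∣)
  (solve 2 (λ p q → p :- q := (con 1ℚ :+ p) :- (con 1ℚ :+ q)) refl (height i) (height j))
  (height-separated i j (i≢j ∘ cong suc))
  where open +-*-Solver

cyclicPred : ∀ {n} → Fin (suc n) → Fin (suc n)
cyclicPred zero    = fromℕ _
cyclicPred (suc i) = inject₁ i

cyclicPred-surjective : ∀ {n} (j : Fin (suc n)) → ∃[ i ] cyclicPred i ≡ j
cyclicPred-surjective j with view j
... | ‵fromℕ     = zero , refl
... | ‵inject₁ i = suc i , refl

-- On a single element the cycle would be the identity, hence the size of at least two.
cyclicPred-derangement : ∀ {n} (i : Fin (suc (suc n))) → cyclicPred i ≢ i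
cyclicPred-derangement (suc i) eq = ℕ.1+n≢n (trans (sym (cong Fin.toℕ eq)) (Fin.toℕ-inject₁ i))

-- The commutator of diag(height) and of the permutation matrix of σ has the entries
-- height (σ i) - height i in the positions (i , σ i).
module Perturbation {m : ℕ} (σ : Fin m → Fin m)
  (surjective : ∀ j → ∃[ i ] σ i ≡ j) (derangement : ∀ i → σ i ≢ i) where

  -- Row i of Aₖ has one entry, `coefficients k i`, in column `columns k i`. The three matrices are
  -- the identity, the diagonal matrix of heights and the permutation matrix of σ.
  coefficients : Fin 3 → Fin m → ℚ[i]
  coefficients 0F _ = 1ᶜ
  coefficients 1F i = real (height i)
  coefficients 2F _ = 1ᶜ

  columns : Fin 3 → Fin m → Fin m
  columns 0F i = i
  columns 1F i = i
  columns 2F i = σ i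

  M : ℚ
  M = ‖ coefficients 1F ‖₁

  -- The first constant collects the three residuals that give the commutator; the other two arise
  -- by recovering x₁ and x₂ from x₀ with one further residual each.
  κ : Fin 3 → ℚ
  κ 0F = 1ℚ + 1ℚ + M
  κ 1F = M * (1ℚ + 1ℚ + M) + 1ℚ
  κ 2F = 1ℚ + 1ℚ + M + 1ℚ

  -- Three residuals combine so that x₁ and x₂ cancel and the commutator applied to x₀ remains. This
  -- is the quantitative form of the fact that exact equations Aₖ xⱼ = Aⱼ xₖ force x = 0.
  entry-bound : ∀ (x : Fin 3 → Index m → ℚ[i]) {θ} →
    (∀ j k i l → ‖ coefficients k i *ᶜ x j (columns k i , l) -ᶜ coefficients j i *ᶜ x k (columns j i , l) ‖ ≤ θ) →
    ∀ j b → ‖ x j b ‖ ≤ κ j * θ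
  entry-bound x {θ} small = bound
    where
    open ℚ.≤-Reasoning
    collect₀ : ∀ θ M → θ + θ + M * θ ≡ (1ℚ + 1ℚ + M) * θ
    collect₀ = solve 2 (λ θ M → θ :+ θ :+ M :* θ := (con 1ℚ :+ con 1ℚ :+ M) :* θ) refl
      where open +-*-Solver
    collect₁ : ∀ a b c → a * (b * c) + c ≡ (a * b + 1ℚ) * c
    collect₁ = solve 3 (λ a b c → a :* (b :* c) :+ c := (a :* b :+ con 1ℚ) :* c) refl
      where open +-*-Solver
    D : Fin m → ℚ[i]
    D i = real (height i)
    ‖D‖≤M : ∀ i → ‖ D i ‖ ≤ M
    ‖D‖≤M i = term≤∑ (λ i → 0≤‖z‖ (D i)) i
    ‖D*‖≤ : ∀ i z {q} → ‖ z ‖ ≤ q → ‖ D i *ᶜ z ‖ ≤ M * q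
    ‖D*‖≤ i z z≤q = ℚ.≤-trans (‖z*w‖≤ (D i) z) (*-mono-≤ (0≤‖z‖ z) (0≤‖d‖₁ D) (‖D‖≤M i) z≤q)
    bound-σ : ∀ i l → ‖ x 0F (σ i , l) ‖ ≤ κ 0F * θ
    bound-σ i l = begin
      ‖ x₀ ‖
        ≤⟨ ‖z‖≤‖real-*‖ x₀ (height-separated (σ i) i (derangement i)) ⟩
      ‖ real (height (σ i) - height i) *ᶜ x₀ ‖
        -- The residual of A₀ and A₁ is taken in row σ i and the other two in row i, so that all of
        -- them involve the same entries of x₀, x₁ and x₂.
        ≡⟨ cong ‖_‖ (solve 5 (λ s t y z w → (s :- t) :* y
             := (s :* y :- con 1ᶜ :* z) :+ (con 1ᶜ :* z :- t :* w) :- t :* (con 1ᶜ :* y :- con 1ᶜ :* w)) refl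
             (D (σ i)) (D i) x₀ x₁ x₂) ⟩
      ‖ y₀₁ +ᶜ y₁₂ -ᶜ D i *ᶜ y₀₂ ‖
        ≤⟨ ‖z-w‖≤ (y₀₁ +ᶜ y₁₂) (D i *ᶜ y₀₂) ⟩
      ‖ y₀₁ +ᶜ y₁₂ ‖ + ‖ D i *ᶜ y₀₂ ‖
        ≤⟨ ℚ.+-monoˡ-≤ ‖ D i *ᶜ y₀₂ ‖ (‖z+w‖≤ y₀₁ y₁₂) ⟩
      ‖ y₀₁ ‖ + ‖ y₁₂ ‖ + ‖ D i *ᶜ y₀₂ ‖
        ≤⟨ ℚ.+-mono-≤ (ℚ.+-mono-≤ (small 0F 1F (σ i) l) (small 1F 2F i l)) (‖D*‖≤ i y₀₂ (small 0F 2F i l)) ⟩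
      θ + θ + M * θ
        ≡⟨ collect₀ θ M ⟩
      κ 0F * θ ∎
      where
      open ℂ-Solver
      x₀ = x 0F (σ i , l)
      x₁ = x 1F (σ i , l)
      x₂ = x 2F (i , l)
      y₀₁ = D (σ i) *ᶜ x₀ -ᶜ 1ᶜ *ᶜ x₁
      y₁₂ = 1ᶜ *ᶜ x₁ -ᶜ D i *ᶜ x₂
      y₀₂ = 1ᶜ *ᶜ x₀ -ᶜ 1ᶜ *ᶜ x₂
    bound : ∀ j b → ‖ x j b ‖ ≤ κ j * θ
    -- Surjectivity of σ carries the bound from the rows σ i to all rows.
    bound 0F (i , l) with surjective i
    ... | i′ , refl = bound-σ i′ l
    bound 1F (i , l) = begin
      ‖ x 1F (i , l) ‖
        ≡⟨ cong ‖_‖ (solve 3 (λ d y z → z := d :* y :- (d :* y :- con 1ᶜ :* z)) refl (D i) (x 0F (i , l)) (x 1F (i , l))) ⟩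
      ‖ D i *ᶜ x 0F (i , l) -ᶜ (D i *ᶜ x 0F (i , l) -ᶜ 1ᶜ *ᶜ x 1F (i , l)) ‖
        ≤⟨ ‖z-w‖≤ (D i *ᶜ x 0F (i , l)) (D i *ᶜ x 0F (i , l) -ᶜ 1ᶜ *ᶜ x 1F (i , l)) ⟩
      ‖ D i *ᶜ x 0F (i , l) ‖ + ‖ D i *ᶜ x 0F (i , l) -ᶜ 1ᶜ *ᶜ x 1F (i , l) ‖
        ≤⟨ ℚ.+-mono-≤ (‖D*‖≤ i (x 0F (i , l)) (bound 0F (i , l))) (small 0F 1F i l) ⟩
      M * (κ 0F * θ) + θ
        ≡⟨ collect₁ M (κ 0F) θ ⟩
      κ 1F * θ ∎
      where
      open ℂ-Solver
    bound 2F (i , l) = begin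
      ‖ x 2F (i , l) ‖
        ≡⟨ cong ‖_‖ (solve 2 (λ y z → z := y :- (con 1ᶜ :* y :- con 1ᶜ :* z)) refl (x 0F (σ i , l)) (x 2F (i , l))) ⟩
      ‖ x 0F (σ i , l) -ᶜ (1ᶜ *ᶜ x 0F (σ i , l) -ᶜ 1ᶜ *ᶜ x 2F (i , l)) ‖
        ≤⟨ ‖z-w‖≤ (x 0F (σ i , l)) (1ᶜ *ᶜ x 0F (σ i , l) -ᶜ 1ᶜ *ᶜ x 2F (i , l)) ⟩
      ‖ x 0F (σ i , l) ‖ + ‖ 1ᶜ *ᶜ x 0F (σ i , l) -ᶜ 1ᶜ *ᶜ x 2F (i , l) ‖
        ≤⟨ ℚ.+-mono-≤ (bound-σ i l) (small 0F 2F i l) ⟩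
      κ 0F * θ + θ
        ≡⟨ cong (λ p → κ 0F * θ + p) (ℚ.*-identityˡ θ) ⟨
      κ 0F * θ + 1ℚ * θ
        ≡⟨ ℚ.*-distribʳ-+ θ (κ 0F) 1ℚ ⟨
      κ 2F * θ ∎
      where open ℂ-Solver

  ‖_‖³ : (Fin 3 → Index m → ℚ[i]) → ℚ
  ‖ x ‖³ = ℚΣ.sum (λ j → ‖ x j ‖ᴹ)

  -- `H` adds `κ` over all 3m² entries; `C` dominates each of the three coefficient norms by their
  -- sum.
  H C : ℚ
  H = ℚΣ.sum (λ j → ℚΣ.sum {m} λ _ → ℚΣ.sum {m} λ _ → κ j)
  C = ℚΣ.sum (λ k → ‖ coefficients k ‖₁)

  total-bound : ∀ (x : Fin 3 → Index m → ℚ[i]) {θ} → (∀ j b → ‖ x j b ‖ ≤ κ j * θ) →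
                ‖ x ‖³ ≤ H * θ
  total-bound x {θ} x≤κθ = begin
    ‖ x ‖³
      ≤⟨ ∑-mono-≤ (λ j → ∑-mono-≤ λ b₁ → ∑-mono-≤ λ b₂ → x≤κθ j (b₁ , b₂)) ⟩
    ℚΣ.sum (λ j → ℚΣ.sum {m} λ _ → ℚΣ.sum {m} λ _ → κ j * θ)
      ≡⟨ ℚΣ.sum-cong-≗ (λ j → trans (ℚΣ.*-distribʳ-sum {m} θ (λ _ → ℚΣ.sum {m} λ _ → κ j))
           (ℚΣ.sum-cong-≗ {m} λ _ → ℚΣ.*-distribʳ-sum {m} θ λ _ → κ j)) ⟨
    ℚΣ.sum (λ j → ℚΣ.sum {m} (λ _ → ℚΣ.sum {m} λ _ → κ j) * θ)
      ≡⟨ ℚΣ.*-distribʳ-sum θ (λ j → ℚΣ.sum {m} λ _ → ℚΣ.sum {m} λ _ → κ j) ⟨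
    H * θ ∎
    where open ℚ.≤-Reasoning

  module _ {ε} (0≤ε : 0ℚ ≤ ε) (t : Index m × Index m × Index m → ℚ[i]) (close : ∀ abc → ‖ matMul abc -ᶜ t abc ‖ ≤ ε)
    (x : Fin 3 → Index m → ℚ[i])
    (symmetric : ∀ j k c → contract (coefficients k) (columns k) (x j) c t ≡ contract (coefficients j) (columns j) (x k) c t)
    where

    η : ℚ
    η = C * (‖ x ‖³ * ε)

    error : Index m × Index m × Index m → ℚ[i]
    error abc = matMul abc -ᶜ t abc

    error-bound : ∀ j k c → ‖ contract (coefficients k) (columns k) (x j) c error ‖ ≤ η
    error-bound j k c = ℚ.≤-trans
      (contract-bound (coefficients k) (columns k) (x j) c error 0≤ε close)
      (*-mono-≤ (0≤* (0≤‖x‖ᴹ (x j)) 0≤ε) (0≤∑ (λ k → 0≤‖d‖₁ (coefficients k)))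
        (term≤∑ (λ k → 0≤‖d‖₁ (coefficients k)) k)
        (ℚ.*-monoʳ-≤-nonNeg ε {{nonNegative 0≤ε}} (term≤∑ (λ j → 0≤‖x‖ᴹ (x j)) j)))

    contract-error : ∀ j k l i → contract (coefficients k) (columns k) (x j) (l , i) error
      ≡ coefficients k i *ᶜ x j (columns k i , l) -ᶜ contract (coefficients k) (columns k) (x j) (l , i) t
    contract-error j k l i = trans
      (linear-sub (contract-isLinear (coefficients k) (columns k) (x j) (l , i)) matMul t)
      (cong (λ z → z -ᶜ contract (coefficients k) (columns k) (x j) (l , i) t)
        (contract-matMul (coefficients k) (columns k) (x j) l i))

    -- By `symmetric` both products are compared with the same contraction of t, each at distance at
    -- most `η`.
    near : ∀ j k i l → ‖ coefficients k i *ᶜ x j (columns k i , l) -ᶜ coefficients j i *ᶜ x k (columns j i , l) ‖ ≤ η + η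
    near j k i l = difference-bound
      (coefficients k i *ᶜ x j (columns k i , l)) (coefficients j i *ᶜ x k (columns j i , l))
      (contract (coefficients k) (columns k) (x j) (l , i) t)
      (contract-error j k l i)
      (trans (contract-error k j l i) (cong (λ z → coefficients j i *ᶜ x k (columns j i , l) -ᶜ z) (sym (symmetric j k (l , i)))))
      (error-bound j k (l , i)) (error-bound k j (l , i))

  -- The radius is fixed before the number of summands and the vectors, hence it serves all tensors
  -- of small rank at once.
  inapproximable : ∃[ ε ] (0ℚ < ε × (∀ {s} → s ℕ.* 2 ℕ.< 3 ℕ.* (m ℕ.* m) → (u v w : Fin s → Index m → ℚ[i]) →
    ¬ (∀ abc → ‖ matMul abc -ᶜ rankSum u v w abc ‖ ≤ ε)))
  inapproximable =
    -- `C + C` accounts for the two errors in `near`, and `H` for the passage from residuals to the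
    -- norm of x.
    let ε , 0<ε , small = small-multiplier (H * (C + C))
        0≤ε = ℚ.<⇒≤ 0<ε
    in ε , 0<ε , λ 2s<3m² u v w close →
      let x , (j , b , x≢0) , symmetric = koszul-kernel 2s<3m² coefficients columns u v w
      in absorbing-bound {H} {C}
           (ℚ.<-≤-trans (0<‖z‖ x≢0) (ℚ.≤-trans (entry≤‖x‖ᴹ (x j) b) (term≤∑ (λ j → 0≤‖x‖ᴹ (x j)) j)))
           small
           (total-bound x (entry-bound x (near 0≤ε (rankSum u v w) close x symmetric)))

-- Rational approximation

_at_ : ℂ → ℕ → ℚ[i]
z at n = seq (re z) n +𝕚 seq (im z) n

sum-at : ∀ {s} (f : Fin s → ℂ) n → Defs.sum f at n ≡ ∑[ p < s ] f p at n
sum-at {zero}  f n = refl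
sum-at {suc s} f n = cong (f zero at n +ᶜ_) (sum-at (f ∘ suc) n)

if-at : ∀ b n → (if b then Defs.1ℂ else Defs.0ℂ) at n ≡ (if b then 1ᶜ else 0ᶜ)
if-at true  n = refl
if-at false n = refl

basis-at : ∀ {m} (i j : Fin m) a n → Defs.∣ i , j ⟩ a at n ≡ basis (i , j) a
basis-at i j a n = if-at (does (≡-dec Fin._≟_ Fin._≟_ a (i , j))) n

-- The entries of `𝓜` are built from constant sequences, so each of their terms is exact.
𝓜-at : ∀ {m} (a b c : Index m) n → 𝓜 m a b c at n ≡ matMul (a , b , c)
𝓜-at {m} a b c n =
  trans (sum-at {m} _ n) (sum-cong-≗ λ i →
  trans (sum-at {m} _ n) (sum-cong-≗ λ j →
  trans (sum-at {m} _ n) (sum-cong-≗ λ l →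
  cong₂ _*ᶜ_ (cong₂ _*ᶜ_ (basis-at i j a n) (basis-at j l b n)) (basis-at l i c n))))

Eventually : (ℕ → Set) → Set
Eventually P = ∃[ N ] (∀ n → N ℕ.≤ n → P n)

eventually-× : ∀ {P Q : ℕ → Set} → Eventually P → Eventually Q → Eventually (λ n → P n × Q n)
eventually-× (M , p) (N , q) = M ℕ.⊔ N , λ n M⊔N≤n → p n (ℕ.m⊔n≤o⇒m≤o M N M⊔N≤n) , q n (ℕ.m⊔n≤o⇒n≤o M N M⊔N≤n)

eventually-map : ∀ {P Q : ℕ → Set} → (∀ n → P n → Q n) → Eventually P → Eventually Q
eventually-map f (N , p) = N , λ n N≤n → f n (p n N≤n)

-- Finitely many thresholds have a maximum; this turns entrywise convergence into one index that
-- serves all entries of a tensor.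
eventually-Fin : ∀ {k} {P : Fin k → ℕ → Set} → (∀ i → Eventually (P i)) → Eventually (λ n → ∀ i → P i n)
eventually-Fin {zero}  ev = 0 , λ _ _ ()
eventually-Fin {suc k} ev = eventually-map (λ { n (p , ps) zero → p ; n (p , ps) (suc i) → ps i })
  (eventually-× (ev zero) (eventually-Fin (ev ∘ suc)))

eventually-Index : ∀ {m} {P : Index m → ℕ → Set} → (∀ a → Eventually (P a)) → Eventually (λ n → ∀ a → P a n)
eventually-Index ev = eventually-map (λ n p (i , j) → p i j)
  (eventually-Fin λ i → eventually-Fin λ j → ev (i , j))

eventually-Index³ : ∀ {m} {P : Index m → Index m → Index m → ℕ → Set} → (∀ a b c → Eventually (P a b c)) →
                    Eventually (λ n → ∀ a b c → P a b c n)
eventually-Index³ ev = eventually-Index λ a → eventually-Index λ b → eventually-Index λ c → ev a b c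

∣p∣≤δ : ∀ {p δ} → 0ℚ < δ → p * p ≤ δ * δ → ∣ p ∣ ≤ δ
∣p∣≤δ {p} {δ} 0<δ p²≤δ² = ℚ.≮⇒≥ λ δ<∣p∣ → ℚ.<-irrefl refl (begin-strict
  δ * δ            <⟨ ℚ.*-monoʳ-<-pos δ {{positive 0<δ}} δ<∣p∣ ⟩
  δ * ∣ p ∣        ≤⟨ ℚ.*-monoʳ-≤-nonNeg ∣ p ∣ {{ℚ.∣-∣-nonNeg p}} (ℚ.<⇒≤ δ<∣p∣) ⟩
  ∣ p ∣ * ∣ p ∣    ≡⟨ ℚ.∣p*q∣≡∣p∣*∣q∣ p p ⟨
  ∣ p * p ∣        ≡⟨ ℚ.0≤p⇒∣p∣≡p (0≤p² p) ⟩
  p * p            ≤⟨ p²≤δ² ⟩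
  δ * δ            ∎)
  where open ℚ.≤-Reasoning

0<q-p⇒p≤q : ∀ {p q} → 0ℚ < q - p → p ≤ q
0<q-p⇒p≤q {p} {q} 0<q-p = subst (p ≤_) (solve 2 (λ p q → (q :- p) :+ p := q) refl p q) (p≤q+p (ℚ.<⇒≤ 0<q-p))
  where open +-*-Solver

∣w-s∣≤ : ∀ {δ} t s w → ∣ t - s ∣ < δ → ∣ t - w ∣ ≤ δ → ∣ w - s ∣ ≤ δ + δ
∣w-s∣≤ {δ} t s w ts<δ tw≤δ = subst (λ q → ∣ q ∣ ≤ δ + δ)
  (solve 3 (λ t s w → (t :- s) :- (t :- w) := w :- s) refl t s w)
  (ℚ.≤-trans (ℚ.∣p-q∣≤∣p∣+∣q∣ (t - s) (t - w)) (ℚ.+-mono-≤ (ℚ.<⇒≤ ts<δ) tw≤δ))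
  where open +-*-Solver

-- Each part of w - s passes through t and picks up two errors of at most δ; the two parts together
-- give four.
close-at : ∀ {δ} → 0ℚ < δ → ∀ t s w → t Defs.≈ s → Defs.∣ t Defs.- w ∣² Defs.<ℝ fromℚ δ Defs.*ℝ fromℚ δ →
           Eventually (λ n → ‖ w at n -ᶜ s at n ‖ ≤ (δ + δ) + (δ + δ))
close-at {δ} 0<δ t s w (re≈ , im≈) (δ′ , 0<δ′ , near) = eventually-map bounds
  (eventually-× (eventually-× (re≈ δ 0<δ) (im≈ δ 0<δ)) near)
  where
  bounds : ∀ n → _ → ‖ w at n -ᶜ s at n ‖ ≤ (δ + δ) + (δ + δ)
  bounds n ((re< , im<) , sq<) = ℚ.+-mono-≤
    (∣w-s∣≤ (seq (re t) n) (seq (re s) n) (seq (re w) n) re<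
      (∣p∣≤δ 0<δ (ℚ.≤-trans (p²≤p²+q² p q) sq≤)))
    (∣w-s∣≤ (seq (im t) n) (seq (im s) n) (seq (im w) n) im<
      (∣p∣≤δ 0<δ (ℚ.≤-trans (q²≤p²+q² p q) sq≤)))
    where
    p = seq (re t) n - seq (re w) n
    q = seq (im t) n - seq (im w) n
    sq≤ : p * p + q * q ≤ δ * δ
    sq≤ = 0<q-p⇒p≤q (ℚ.<-trans 0<δ′ sq<)

-- Two choices follow each other: a member K of the convergent sequence of tensors, then a term N of
-- the Cauchy sequences in its rank decomposition. The number of summands does not change when the
-- decomposition is evaluated at N.
approximate : ∀ {m r} → BorderRank≤ (𝓜 m) r → ∀ ε → 0ℚ < ε →
  ∃[ s ] (s ℕ.≤ r × ∃ λ (u : Fin s → Index m → ℚ[i]) → ∃₂ λ v w → ∀ abc → ‖ matMul abc -ᶜ rankSum u v w abc ‖ ≤ ε)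
approximate {m} (t , rank , conv) ε 0<ε =
  let K , conv-K = eventually-Index³ λ a b c → conv a b c (fromℚ ε′) 0<fromℚε′
      s , s≤r , u , v , x , t≈ = rank K
      N , close = eventually-Index³ λ a b c →
        close-at 0<ε′ (t K a b c) (Defs.sumᵀ (λ p → Defs.⟨ u p ⊗ v p ⊗ x p ⟩) a b c) (𝓜 m a b c)
                 (t≈ a b c) (conv-K K ℕ.≤-refl a b c)
  in s , s≤r , (λ p a → u p a at N) , (λ p b → v p b at N) , (λ p c → x p c at N) ,
     λ (a , b , c) → subst₂ (λ z q → ‖ z ‖ ≤ q)
       (cong₂ _-ᶜ_ (𝓜-at a b c N) (sum-at (λ p → Defs.⟨ u p ⊗ v p ⊗ x p ⟩ a b c) N))
       (solve 1 (λ ε → (con ¼ :* ε :+ con ¼ :* ε) :+ (con ¼ :* ε :+ con ¼ :* ε) := ε) refl ε)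
       (close N ℕ.≤-refl a b c)
  where
  open +-*-Solver
  ¼ ε′ : ℚ
  ¼ = + 1 / 4
  -- A quarter, because `close-at` yields four times its parameter.
  ε′ = ¼ * ε
  0<ε′ : 0ℚ < ε′
  0<ε′ = subst (_< ε′) (ℚ.*-zeroʳ ¼) (ℚ.*-monoʳ-<-pos ¼ 0<ε)
  0<fromℚε′ : Defs.0ℝ Defs.<ℝ fromℚ ε′
  -- The order on reals asks for a positive gap, here any rational strictly between 0 and `ε′`.
  0<fromℚε′ = let q , 0<q , q<ε′ = ℚ.<-dense 0<ε′ in q , 0<q , 0 , λ _ _ → subst (q <_) (sym (ℚ.+-identityʳ ε′)) q<ε′

-- Lower bounds on the border rank

borderRank-bound : ∀ {n r} → BorderRank≤ (𝓜 (2 ℕ.+ n)) r → 3 ℕ.* ((2 ℕ.+ n) ℕ.* (2 ℕ.+ n)) ℕ.≤ r ℕ.* 2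
borderRank-bound {n} b = ℕ.≮⇒≥ λ 2r<3m² →
  -- The size 2 + n is what makes the cyclic permutation free of fixed points.
  let ε , 0<ε , far = Perturbation.inapproximable (cyclicPred {suc n}) cyclicPred-surjective cyclicPred-derangement
      s , s≤r , u , v , w , close = approximate b ε 0<ε
  in far (ℕ.≤-<-trans (ℕ.*-monoˡ-≤ 2 s≤r) 2r<3m²) u v w close

-- The subtracted `0ᶜ` is the value of an empty `rankSum`.
matMul-1 : ‖ matMul {1} ((zero , zero) , (zero , zero) , (zero , zero)) -ᶜ 0ᶜ ‖ ≡ 1ℚ
matMul-1 = refl

-- For m = 1 no derangement exists, and the bound 3/2 - 1/2 = 1 amounts to excluding rank 0: the
-- zero tensor stays at distance 1.
borderRank-pos : ¬ BorderRank≤ (𝓜 1) 0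
borderRank-pos b = far (approximate b ½ (ℚ.positive⁻¹ ½))
  where
  far : ¬ (∃[ s ] (s ℕ.≤ 0 × ∃ λ (u : Fin s → Index 1 → ℚ[i]) → ∃₂ λ v w →
             ∀ abc → ‖ matMul abc -ᶜ rankSum u v w abc ‖ ≤ ½))
  far (zero , z≤n , u , v , w , close) = toWitnessFalse {a? = 1ℚ ℚ.≤? ½} _
    (subst (_≤ ½) matMul-1 (close ((zero , zero) , (zero , zero) , (zero , zero))))

-- Rational division normalises by a gcd, which does not reduce for variables. Between unnormalised
-- fractions the inequality is the cross-multiplied one of the hypothesis.
fraction-≤ : ∀ a b {k r} → a ℕ.* k ℕ.≤ r ℕ.* suc b → (+ a / suc b) * toℚ k ≤ toℚ r
fraction-≤ a b {k} {r} ak≤rb = ℚ.toℚᵘ-cancel-≤ (begin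
  toℚᵘ ((+ a / suc b) * toℚ k)
    ≃⟨ ℚ.toℚᵘ-homo-* (+ a / suc b) (toℚ k) ⟩
  toℚᵘ (+ a / suc b) ℚᵘ.* toℚᵘ (toℚ k)
    ≃⟨ ℚᵘ.*-cong (ℚ.toℚᵘ-fromℚᵘ (ℚᵘ.mkℚᵘ (+ a) b)) (ℚ.toℚᵘ-fromℚᵘ (ℚᵘ.mkℚᵘ (+ k) 0)) ⟩
  ℚᵘ.mkℚᵘ (+ a) b ℚᵘ.* ℚᵘ.mkℚᵘ (+ k) 0
    ≤⟨ ℚᵘ.*≤* (subst₂ ℤ._≤_
         (trans (ℤ.pos-* a k) (sym (ℤ.*-identityʳ (+ a ℤ.* + k))))
         (trans (ℤ.pos-* r (suc b)) (cong (λ n → + r ℤ.* + n) (sym (ℕ.*-identityʳ (suc b)))))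
         (ℤ.+≤+ ak≤rb)) ⟩
  ℚᵘ.mkℚᵘ (+ r) 0
    ≃⟨ ℚ.toℚᵘ-fromℚᵘ (ℚᵘ.mkℚᵘ (+ r) 0) ⟨
  toℚᵘ (toℚ r) ∎)
  where open ℚᵘ.≤-Reasoning

p-q≤p : ∀ {p q} → 0ℚ ≤ q → p - q ≤ p
p-q≤p {p} 0≤q = ℚ.≤-trans (ℚ.+-monoʳ-≤ p (ℚ.neg-antimono-≤ 0≤q)) (ℚ.≤-reflexive (ℚ.+-identityʳ p))

borderRank-bound-½ : ∀ m r → BorderRank≤ (𝓜 m) r → (+ 3 / 2) * toℚ (m ^ 2) - ½ ≤ toℚ r
borderRank-bound-½ 0 r _ = ℚ.≤-trans (p-q≤p (ℚ.nonNegative⁻¹ ½)) (fraction-≤ 3 1 {0} {r} z≤n)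
borderRank-bound-½ 1 zero b = contradiction b borderRank-pos
-- The left-hand side is closed and evaluates to 1, just like `(+ 1 / 1) * toℚ 1`.
borderRank-bound-½ 1 (suc r) _ = fraction-≤ 1 0 {1} {suc r} (s≤s z≤n)
borderRank-bound-½ m@(suc (suc _)) r b = ℚ.≤-trans (p-q≤p (ℚ.nonNegative⁻¹ ½))
  -- `m ^ 2` unfolds to `m * (m * 1)`, so the trailing factor 1 has to be rewritten.
  (fraction-≤ 3 1 {m ^ 2} {r} (subst (λ k → 3 ℕ.* (m ℕ.* k) ℕ.≤ r ℕ.* 2) (sym (ℕ.*-identityʳ m)) (borderRank-bound b)))

theorem4p5 : (m r : ℕ) → IsBorderRank (𝓜 m) r →
    (¬ (2 ∣ m) → (+ 3 / 2) * toℚ (m ^ 2) - ½ ≤ toℚ r) ×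
    (2 ∣ m → (+ 3 / 2) * toℚ (m ^ 2) - toℚ 2 ≤ toℚ r)
theorem4p5 m r (b , _) =
  (λ _ → borderRank-bound-½ m r b) ,
  (λ _ → ℚ.≤-trans (ℚ.+-monoʳ-≤ ((+ 3 / 2) * toℚ (m ^ 2)) (toWitness {a? = (- toℚ 2) ℚ.≤? (- ½)} _)) (borderRank-bound-½ m r b))
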